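{- Let $G$ and $G_0$ be cacti-graphs with $G_0$ a subgraph of $G$. Then either $G=G_0$ or there exist sequences $(P_1,\dots,P_r)$ and $(G_0,G_1,\dots,G_r)$ of subgraphs of $G$ such that $G_r=G$, every $G_i$ is a cacti-graph, and for every $i\in\{1,\dots,r\}$: $G_i=G_{i-1}\cup P_i$ with $E(P_i)\cap E(G_{i-1})=\emptyset$, where $P_i$ is a path, a cycle, a lollipop, or a bicycle, and (p) if $P_i$ is a path then $V(G_{i-1})\cap V(P_i)=End(P_i)$; (l) if $P_i$ is a lollipop then $V(G_{i-1})\cap V(P_i)=End(P_i)$; (c) if $P_i$ is a cycle then $|V(G_{i-1})\cap V(P_i)|=1$; (b) if $P_i$ is a bicycle then $V(G_{i-1})\cap V(P_i)=\emptyset$. Consequently $G_{i-1}$ is a proper subgraph of $G_i$ and $\Delta G_i-\Delta G_{i-1}=1$ for all $i$.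
   Context: Graphs are finite, may have loops and parallel edges, and have no isolated vertices unless stated otherwise. A leaf is a vertex incident to exactly one edge, which is not a loop. $\Delta G=|E(G)|-|V(G)|$. A cycle is a connected graph all of whose vertices have degree 2 (a loop contributes 2; a single vertex with a loop is a cycle). An $(x,y)$-path is a path with distinct end vertices $x,y$ and at least one edge, and $End(P)=\{x,y\}$. A lollipop is a graph obtained from a cycle $C$ (possibly a loop) and a vertex-disjoint path $P$ with end vertices $y,x$ by identifying a vertex of $C$ with $y$; $End(Q)=\{x\}$. A bicycle is a connected graph with no leaves and $\Delta=1$. A cacti-graph is a graph with no isolated vertices, no leaves, and no component that is a cycle (equivalently, no isolated vertices, no leaves, and every component contains at least two cycles). -}

module Defs where

open import Data.Nat.Base using (ℕ; _+_)
open import Data.Integer.Base as ℤ using (ℤ; +_)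
open import Data.Fin.Base using (Fin)
open import Data.Fin.Properties using (_≟_)
open import Data.Fin.Subset using (Subset; _∈_; _⊆_; _∩_; _∪_; ⊤; ⁅_⁆; ∣_∣)
open import Data.Fin.Subset.Properties using (∈⊤; x∈p∪q⁻; x∈p∪q⁺)
open import Data.List.Base using (List; []; _∷_)
open import Data.List.Relation.Unary.Unique.Propositional using (Unique)
import Data.List.Membership.Propositional as List
open import Data.Product.Base using (Σ-syntax; ∃; ∃-syntax; ∃₂; _×_; _,_; proj₁; proj₂)
open import Data.Sum.Base using (_⊎_; inj₁; inj₂)
open import Data.Vec.Base using (tabulate)
open import Relation.Binary.Construct.Closure.ReflexiveTransitive using (Star; ε; _◅_)
open import Relation.Binary.PropositionalEquality using (_≡_; _≢_)
open import Relation.Nullary using (¬_; does)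

-- Edges are undirected: the order of the two ends `src e`, `tgt e` is an
-- artefact of the encoding, and every notion below is symmetric in them.
record Multigraph : Set where
  field
    nV nE   : ℕ
    src tgt : Fin nE → Fin nV

  Vertex Edge : Set
  Vertex = Fin nV
  Edge   = Fin nE

  Incident : Vertex → Edge → Set
  Incident v e = src e ≡ v ⊎ tgt e ≡ v

  Loop : Edge → Set
  Loop e = src e ≡ tgt e

  Joins : Edge → Vertex → Vertex → Set
  Joins e u v = (src e ≡ u × tgt e ≡ v) ⊎ (src e ≡ v × tgt e ≡ u)

-- All graph-theoretic notions are defined for subgraphs of an ambient
-- multigraph `G`; `G` itself is the subgraph `whole G`.
record Subgraph (G : Multigraph) : Set where
  constructor mkSubgraph
  open Multigraph G
  field
    V      : Subset nV
    E      : Subset nE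
    closed : ∀ {e} → e ∈ E → src e ∈ V × tgt e ∈ V

open Subgraph public using (V; E)

whole : (G : Multigraph) → Subgraph G
whole G = mkSubgraph ⊤ ⊤ (λ _ → ∈⊤ , ∈⊤)

module _ {G : Multigraph} where
  open Multigraph G

  infix  4 _≋_ _⊑_ _⊏_
  infixr 6 _∪ᴳ_

  _≋_ : Subgraph G → Subgraph G → Set
  H ≋ K = V H ≡ V K × E H ≡ E K

  _⊑_ : Subgraph G → Subgraph G → Set
  H ⊑ K = V H ⊆ V K × E H ⊆ E K

  _⊏_ : Subgraph G → Subgraph G → Set
  H ⊏ K = H ⊑ K × ¬ (H ≋ K)

  _∪ᴳ_ : Subgraph G → Subgraph G → Subgraph G
  H ∪ᴳ K = mkSubgraph (V H ∪ V K) (E H ∪ E K) closed-∪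
    where
    closed-∪ : ∀ {e} → e ∈ E H ∪ E K → src e ∈ V H ∪ V K × tgt e ∈ V H ∪ V K
    closed-∪ e∈ with x∈p∪q⁻ (E H) (E K) e∈
    ... | inj₁ e∈H = let s , t = Subgraph.closed H e∈H in x∈p∪q⁺ (inj₁ s) , x∈p∪q⁺ (inj₁ t)
    ... | inj₂ e∈K = let s , t = Subgraph.closed K e∈K in x∈p∪q⁺ (inj₂ s) , x∈p∪q⁺ (inj₂ t)

  Δ : Subgraph G → ℤ
  Δ H = + ∣ E H ∣ ℤ.- + ∣ V H ∣

  -- A loop at v is counted in both summands, hence contributes 2.
  degree : Subgraph G → Vertex → ℕ
  degree H v = ∣ E H ∩ tabulate (λ e → does (src e ≟ v)) ∣
             + ∣ E H ∩ tabulate (λ e → does (tgt e ≟ v)) ∣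

  IsolatedIn : Subgraph G → Vertex → Set
  IsolatedIn H v = v ∈ V H × (∀ {e} → e ∈ E H → ¬ Incident v e)

  LeafOf : Subgraph G → Vertex → Set
  LeafOf H v = v ∈ V H ×
    ∃[ e ] (e ∈ E H × Incident v e × ¬ Loop e ×
            (∀ {f} → f ∈ E H → Incident v f → f ≡ e))

  record Step (H : Subgraph G) (u v : Vertex) : Set where
    constructor step
    field
      edge  : Edge
      edge∈ : edge ∈ E H
      joins : Joins edge u v

  Walk : Subgraph G → Vertex → Vertex → Set
  Walk H = Star (Step H)

  vertices : ∀ {H : Subgraph G} {u v} → Walk H u v → List Vertex
  vertices {u = u} ε       = u ∷ []
  vertices {u = u} (_ ◅ w) = u ∷ vertices w

  edges : ∀ {H : Subgraph G} {u v} → Walk H u v → List Edge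
  edges ε       = []
  edges (s ◅ w) = Step.edge s ∷ edges w

  -- The empty graph is not connected.
  Connected : Subgraph G → Set
  Connected H = (∃[ v ] v ∈ V H) × (∀ {u v} → u ∈ V H → v ∈ V H → Walk H u v)

  ComponentOf : Subgraph G → Subgraph G → Set
  ComponentOf H K = K ⊑ H × Connected K ×
    (∀ K′ → K′ ⊑ H → Connected K′ → K ⊑ K′ → K′ ⊑ K)

  IsCycle : Subgraph G → Set
  IsCycle C = Connected C × (∀ {v} → v ∈ V C → degree C v ≡ 2)

  -- P consists exactly of the vertices and edges of a walk from x to y
  -- without repeated vertices; x ≢ y forces at least one edge.
  PathBetween : Subgraph G → Vertex → Vertex → Set
  PathBetween P x y = x ≢ y ×
    Σ[ w ∈ Walk P x y ] (Unique (vertices w)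
                        × (∀ {v} → v ∈ V P → v List.∈ vertices w)
                        × (∀ {e} → e ∈ E P → e List.∈ edges w))

  IsPath : Subgraph G → Set
  IsPath P = ∃₂ (PathBetween P)

  -- Identifying a vertex of C with the end y of P amounts, inside an ambient
  -- graph, to C and P having exactly the vertex y in common.
  LollipopWithEnd : Subgraph G → Vertex → Set
  LollipopWithEnd Q x = ∃[ C ] ∃[ P ] ∃[ y ]
    (IsCycle C × PathBetween P y x × V C ∩ V P ≡ ⁅ y ⁆ × Q ≋ C ∪ᴳ P)

  IsLollipop : Subgraph G → Set
  IsLollipop Q = ∃ (LollipopWithEnd Q)

  IsBicycle : Subgraph G → Set
  IsBicycle B = Connected B × (∀ v → ¬ LeafOf B v) × Δ B ≡ + 1

  record IsCacti (H : Subgraph G) : Set where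
    field
      noIsolated       : ∀ v → ¬ IsolatedIn H v
      noLeaf           : ∀ v → ¬ LeafOf H v
      noCycleComponent : ∀ K → ComponentOf H K → ¬ IsCycle K

{-# OPTIONS --safe #-}

-- Suppose some edge outside H has an end v in H. Follow it out of H greedily: as G has no
-- leaves, the trail goes on until it meets H at another vertex (a path), returns to v (a
-- cycle), or runs into itself (a lollipop). Otherwise H is a union of components of G, and
-- a component avoiding H contains a cycle C, found by the same procedure started from a
-- single vertex. Since C is not a component, some edge leaves it, and attaching an ear to C
-- yields a bicycle disjoint from H. A graph is cacti iff all degrees are at least 2 and
-- every vertex is joined by a walk to one of degree at least 3; attachments preserve this.
module Submission where

open import Data.Bool.Base using (Bool; true; false; if_then_else_)
open import Data.Nat.Base using (ℕ; zero; suc; _+_; _≤_; _<_; z≤n; s≤s)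
open import Data.Nat.Properties using
  (+-commutativeSemigroup; +-cancelʳ-≡; +-cancelʳ-≤; +-monoʳ-≤; <-irrefl; 1+n≢n; m≢1+m+n;
   module ≤-Reasoning; +-suc; +-comm; +-assoc; suc-injective; +-identityʳ; +-mono-≤; m≤m+n;
   m≤n+m; ≤-trans; ≤-reflexive; ≤⇒≯; ≤-refl; n≤0⇒n≡0)
open import Algebra.Properties.CommutativeSemigroup +-commutativeSemigroup using (interchange)
open import Data.Nat.Solver using (module +-*-Solver)
import Data.Integer.Base as ℤ
open import Data.Integer.Properties using (+-injective)
open import Data.Integer.Solver using () renaming (module +-*-Solver to ℤ-Solver)
open import Data.Fin.Base using (Fin; zero; suc; inject₁; fromℕ)
open import Data.Fin.Properties using (_≟_; any?)
open import Data.Fin.Subset using (Subset; _∈_; _∉_; _⊆_; _∩_; _∪_; ⊥; ⁅_⁆; ∣_∣; Empty)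
open import Data.Fin.Subset.Properties using
  (_∈?_; x∈⁅x⁆; x∈⁅y⁆⇒x≡y; ∣⁅x⁆∣≡1; x∈p∩q⁺; x∈p∩q⁻; x∈p∪q⁺; x∈p∪q⁻; ∩-distribʳ-∪; ∩-zeroˡ;
   p⊆q⇒∣p∣≤∣q∣; ∉⊥; ∣⊥∣≡0; ∣p∣≤n; ∣p∣≤∣p∪q∣; Empty-unique; ∪-comm; ∈⊤; ⊆⊤; ⊆-antisym; p⊆p∪q;
   q⊆p∪q)
open import Data.List.Base using (List; []; _∷_)
open import Data.List.Relation.Unary.Any using (here; there)
open import Data.List.Relation.Unary.All as All using (All)
open import Data.List.Relation.Unary.AllPairs using ([]; _∷_)
open import Data.List.Relation.Unary.Unique.Propositional using (Unique)
import Data.List.Membership.Propositional as List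
import Data.List.Membership.DecPropositional as DecList
open import Data.Vec.Base using (tabulate; []; _∷_)
open import Data.Vec.Properties using (lookup∘tabulate; []=⇒lookup)
open import Data.Product.Base using (∃-syntax; Σ-syntax; _×_; _,_; proj₁; proj₂)
open import Data.Sum.Base using (_⊎_; inj₁; inj₂; [_,_]′)
open import Function.Base using (_∘_)
open import Relation.Binary.Construct.Closure.ReflexiveTransitive using (ε; _◅_; _◅◅_; reverse)
open import Relation.Binary.PropositionalEquality using
  (_≡_; _≢_; refl; sym; trans; cong; cong₂; subst; module ≡-Reasoning)
open import Relation.Nullary using (¬_; Dec; yes; no; does; contradiction; _×-dec_; _⊎-dec_; ¬?)
open import Relation.Nullary.Decidable using (dec-true; dec-false)
open import Defs

-- The absence of cycle components quantifies over subgraphs and is awkward to carry through a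
-- union. Degrees and walks only grow when a piece is added, which is why the degree criterion
-- serves as the invariant. To derive it from `IsCacti`, a vertex of degree 3 must be found: it is
-- the point of a bicycle where the ear meets the cycle, of degree at least 2 + 1. So bicycles are
-- both pieces to attach and witnesses for the criterion. All counting rests on one identity, |E(P)|
-- + |V(K) ∩ V(P)| = |V(P)| + 1, which says that Δ rises by one. A path has one edge fewer than
-- vertices and two contacts with K; a cycle or a lollipop has as many edges as vertices and one
-- contact; a bicycle has one edge more and no contact. The identity also makes the edge set grow,
-- which bounds the number of steps. The edges of a cycle are counted while it is built, not derived
-- from its degrees by a degree sum.

-- Counting in finite sets

∣p∪q∣+∣p∩q∣≡∣p∣+∣q∣ : ∀ {n} (p q : Subset n) → ∣ p ∪ q ∣ + ∣ p ∩ q ∣ ≡ ∣ p ∣ + ∣ q ∣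
∣p∪q∣+∣p∩q∣≡∣p∣+∣q∣ []          []          = refl
∣p∪q∣+∣p∩q∣≡∣p∣+∣q∣ (false ∷ p) (false ∷ q) = ∣p∪q∣+∣p∩q∣≡∣p∣+∣q∣ p q
∣p∪q∣+∣p∩q∣≡∣p∣+∣q∣ (true ∷ p)  (false ∷ q) = cong suc (∣p∪q∣+∣p∩q∣≡∣p∣+∣q∣ p q)
∣p∪q∣+∣p∩q∣≡∣p∣+∣q∣ (false ∷ p) (true ∷ q)  =
  trans (cong suc (∣p∪q∣+∣p∩q∣≡∣p∣+∣q∣ p q)) (sym (+-suc ∣ p ∣ ∣ q ∣))
∣p∪q∣+∣p∩q∣≡∣p∣+∣q∣ (true ∷ p)  (true ∷ q)  = cong suc
  (trans (+-suc ∣ p ∪ q ∣ ∣ p ∩ q ∣)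
  (trans (cong suc (∣p∪q∣+∣p∩q∣≡∣p∣+∣q∣ p q)) (sym (+-suc ∣ p ∣ ∣ q ∣))))

Disjoint : ∀ {n} → Subset n → Subset n → Set
Disjoint p q = ∀ {x} → x ∈ p → x ∉ q

Disjoint⇒Empty : ∀ {n} {p q : Subset n} → Disjoint p q → Empty (p ∩ q)
Disjoint⇒Empty {p = p} {q} p#q (x , x∈) = let x∈p , x∈q = x∈p∩q⁻ p q x∈ in p#q x∈p x∈q

∣∪∣-disjoint : ∀ {n} {p q : Subset n} → Disjoint p q → ∣ p ∪ q ∣ ≡ ∣ p ∣ + ∣ q ∣
∣∪∣-disjoint {n} {p} {q} p#q = begin
  ∣ p ∪ q ∣              ≡⟨ +-identityʳ _ ⟨
  ∣ p ∪ q ∣ + 0          ≡⟨ cong (λ k → ∣ p ∪ q ∣ + k) ∣p∩q∣≡0 ⟨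
  ∣ p ∪ q ∣ + ∣ p ∩ q ∣  ≡⟨ ∣p∪q∣+∣p∩q∣≡∣p∣+∣q∣ p q ⟩
  ∣ p ∣ + ∣ q ∣          ∎
  where
  open ≡-Reasoning
  ∣p∩q∣≡0 : ∣ p ∩ q ∣ ≡ 0
  ∣p∩q∣≡0 = trans (cong ∣_∣ (Empty-unique (Disjoint⇒Empty p#q))) (∣⊥∣≡0 n)

⁅⁆-disjoint : ∀ {n} {x : Fin n} {p} → x ∉ p → Disjoint ⁅ x ⁆ p
⁅⁆-disjoint {x = x} {p} x∉p y∈ y∈p = x∉p (subst (_∈ p) (x∈⁅y⁆⇒x≡y x y∈) y∈p)

⁅⁆⊆ : ∀ {n} {x : Fin n} {p} → x ∈ p → ⁅ x ⁆ ⊆ p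
⁅⁆⊆ {x = x} {p} x∈p y∈ = subst (_∈ p) (sym (x∈⁅y⁆⇒x≡y x y∈)) x∈p

∣⁅x⁆∪p∣ : ∀ {n} {x : Fin n} {p} → x ∉ p → ∣ ⁅ x ⁆ ∪ p ∣ ≡ suc ∣ p ∣
∣⁅x⁆∪p∣ {x = x} {p} x∉p = trans (∣∪∣-disjoint (⁅⁆-disjoint x∉p)) (cong (_+ ∣ p ∣) (∣⁅x⁆∣≡1 x))

∣⁅x⁆∩tabulate∣ : ∀ {n} (x : Fin n) (f : Fin n → Bool) →
                ∣ ⁅ x ⁆ ∩ tabulate f ∣ ≡ (if f x then 1 else 0)
∣⁅x⁆∩tabulate∣ {suc n} zero f with f zero
... | true  = cong suc (trans (cong ∣_∣ (∩-zeroˡ (tabulate (f ∘ suc)))) (∣⊥∣≡0 n))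
... | false = trans (cong ∣_∣ (∩-zeroˡ (tabulate (f ∘ suc)))) (∣⊥∣≡0 n)
∣⁅x⁆∩tabulate∣ (suc x) f = ∣⁅x⁆∩tabulate∣ x (f ∘ suc)

∈-tabulate⁻ : ∀ {n} {f : Fin n → Bool} {x} → x ∈ tabulate f → f x ≡ true
∈-tabulate⁻ {f = f} {x} x∈ = trans (sym (lookup∘tabulate f x)) ([]=⇒lookup x∈)

fromList : ∀ {n} → List (Fin n) → Subset n
fromList []       = ⊥
fromList (x ∷ xs) = ⁅ x ⁆ ∪ fromList xs

∈-fromList⁺ : ∀ {n} {x : Fin n} {xs} → x List.∈ xs → x ∈ fromList xs
∈-fromList⁺ {x = x} (here refl) = x∈p∪q⁺ (inj₁ (x∈⁅x⁆ x))
∈-fromList⁺         (there x∈)  = x∈p∪q⁺ (inj₂ (∈-fromList⁺ x∈))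

∈-fromList⁻ : ∀ {n} {x : Fin n} xs → x ∈ fromList xs → x List.∈ xs
∈-fromList⁻ []       x∈ = contradiction x∈ ∉⊥
∈-fromList⁻ (y ∷ xs) x∈ with x∈p∪q⁻ ⁅ y ⁆ (fromList xs) x∈
... | inj₁ x∈⁅y⁆ = here (x∈⁅y⁆⇒x≡y y x∈⁅y⁆)
... | inj₂ x∈xs  = there (∈-fromList⁻ xs x∈xs)

≟-true⁻ : ∀ {n} {u v : Fin n} → does (u ≟ v) ≡ true → u ≡ v
≟-true⁻ {u = u} {v} _ with yes u≡v ← u ≟ v = u≡v

≡1⇒≱2 : ∀ {n} → n ≡ 1 → ¬ 2 ≤ n
≡1⇒≱2 refl (s≤s ())

≡1⇒≢2 : ∀ {n} → n ≡ 1 → n ≢ 2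
≡1⇒≢2 refl ()

-- Degrees and incidence

module _ {G : Multigraph} where
  open Multigraph G

  -- Kronecker delta. An edge contributes one delta per end, so a loop gets its 2 without a case
  -- distinction.
  δ : Vertex → Vertex → ℕ
  δ u v = if does (u ≟ v) then 1 else 0

  δ-refl : ∀ v → δ v v ≡ 1
  δ-refl v = cong (if_then 1 else 0) (dec-true (v ≟ v) refl)

  δ-≢ : ∀ {u v} → u ≢ v → δ u v ≡ 0
  δ-≢ {u} {v} u≢v = cong (if_then 1 else 0) (dec-false (u ≟ v) u≢v)

  outgoing incoming : Vertex → Subset nE
  outgoing v = tabulate (λ e → does (src e ≟ v))
  incoming v = tabulate (λ e → does (tgt e ≟ v))

  -- `degree H` unfolds to `deg (E H)`.
  deg : Subset nE → Vertex → ℕ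
  deg F v = ∣ F ∩ outgoing v ∣ + ∣ F ∩ incoming v ∣

  deg-⁅⁆ : ∀ e v → deg ⁅ e ⁆ v ≡ δ (src e) v + δ (tgt e) v
  deg-⁅⁆ e v = cong₂ _+_ (∣⁅x⁆∩tabulate∣ e _) (∣⁅x⁆∩tabulate∣ e _)

  deg-joins : ∀ {e x y} → Joins e x y → ∀ v → deg ⁅ e ⁆ v ≡ δ x v + δ y v
  deg-joins {e} (inj₁ (refl , refl)) v = deg-⁅⁆ e v
  deg-joins {e} (inj₂ (refl , refl)) v = trans (deg-⁅⁆ e v) (+-comm (δ (src e) v) _)

  deg-∪ : ∀ {F F′} → Disjoint F F′ → ∀ v → deg (F ∪ F′) v ≡ deg F v + deg F′ v
  deg-∪ {F} {F′} F#F′ v = trans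
    (cong₂ _+_ (split (outgoing v)) (split (incoming v)))
    (interchange (∣ F ∩ outgoing v ∣) (∣ F′ ∩ outgoing v ∣) (∣ F ∩ incoming v ∣) (∣ F′ ∩ incoming v ∣))
    where
    split : ∀ p → ∣ (F ∪ F′) ∩ p ∣ ≡ ∣ F ∩ p ∣ + ∣ F′ ∩ p ∣
    split p = trans (cong ∣_∣ (∩-distribʳ-∪ p F F′))
      (∣∪∣-disjoint (λ x∈ x∈′ → F#F′ (proj₁ (x∈p∩q⁻ F p x∈)) (proj₁ (x∈p∩q⁻ F′ p x∈′))))

  -- Inclusion is asked only of the edges at `v`: this is all that a leaf, or a vertex of a
  -- component, provides.
  deg-mono : ∀ {F F′ v} → (∀ {e} → e ∈ F → Incident v e → e ∈ F′) → deg F v ≤ deg F′ v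
  deg-mono {F} {F′} {v} F⊆F′ = +-mono-≤
    (p⊆q⇒∣p∣≤∣q∣ (λ e∈ → let e∈F , s = x∈p∩q⁻ F (outgoing v) e∈ in
      x∈p∩q⁺ (F⊆F′ e∈F (inj₁ (≟-true⁻ (∈-tabulate⁻ s))) , s)))
    (p⊆q⇒∣p∣≤∣q∣ (λ e∈ → let e∈F , t = x∈p∩q⁻ F (incoming v) e∈ in
      x∈p∩q⁺ (F⊆F′ e∈F (inj₂ (≟-true⁻ (∈-tabulate⁻ t))) , t)))

  deg-⊥ : ∀ v → deg ⊥ v ≡ 0
  deg-⊥ v = cong₂ _+_ (empty (outgoing v)) (empty (incoming v))
    where
    empty : ∀ p → ∣ ⊥ ∩ p ∣ ≡ 0
    empty p = trans (cong ∣_∣ (∩-zeroˡ p)) (∣⊥∣≡0 nE)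

  deg-none : ∀ {F v} → (∀ {e} → e ∈ F → ¬ Incident v e) → deg F v ≡ 0
  deg-none {F} {v} none = n≤0⇒n≡0
    (≤-trans (deg-mono {F} {⊥} (λ e∈ i → contradiction i (none e∈))) (≤-reflexive (deg-⊥ v)))

  incident? : ∀ v e → Dec (Incident v e)
  incident? v e = src e ≟ v ⊎-dec tgt e ≟ v

  Joins⇒Incidentˡ : ∀ {e u v} → Joins e u v → Incident u e
  Joins⇒Incidentˡ (inj₁ (s , _)) = inj₁ s
  Joins⇒Incidentˡ (inj₂ (_ , t)) = inj₂ t

  Joins-sym : ∀ {e u v} → Joins e u v → Joins e v u
  Joins-sym (inj₁ j) = inj₂ j
  Joins-sym (inj₂ j) = inj₁ j

  Joins-≢⇒¬Loop : ∀ {e u v} → Joins e u v → u ≢ v → ¬ Loop e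
  Joins-≢⇒¬Loop (inj₁ (refl , refl)) u≢v l = u≢v l
  Joins-≢⇒¬Loop (inj₂ (refl , refl)) u≢v l = u≢v (sym l)

  Incident⇒Joins : ∀ {v e} → Incident v e → ∃[ u ] Joins e v u
  Incident⇒Joins (inj₁ s) = _ , inj₁ (s , refl)
  Incident⇒Joins (inj₂ t) = _ , inj₂ (refl , t)

  Incident-Joins : ∀ {e u v x} → Joins e u v → Incident x e → x ≡ u ⊎ x ≡ v
  Incident-Joins (inj₁ (refl , refl)) (inj₁ refl) = inj₁ refl
  Incident-Joins (inj₁ (refl , refl)) (inj₂ refl) = inj₂ refl
  Incident-Joins (inj₂ (refl , refl)) (inj₁ refl) = inj₂ refl
  Incident-Joins (inj₂ (refl , refl)) (inj₂ refl) = inj₁ refl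

  Incident⇒∈V : ∀ (H : Subgraph G) {e v} → e ∈ E H → Incident v e → v ∈ V H
  Incident⇒∈V H e∈ (inj₁ refl) = proj₁ (Subgraph.closed H e∈)
  Incident⇒∈V H e∈ (inj₂ refl) = proj₂ (Subgraph.closed H e∈)

  deg-pos⁺ : ∀ {F v e} → e ∈ F → Incident v e → 1 ≤ deg F v
  deg-pos⁺ {F} {v} {e} e∈ i = ≤-trans one≤
    (deg-mono {⁅ e ⁆} {F} (λ f∈ _ → ⁅⁆⊆ e∈ f∈))
    where
    one≤ : 1 ≤ deg ⁅ e ⁆ v
    one≤ with u , j ← Incident⇒Joins i rewrite deg-joins j v | δ-refl v = s≤s z≤n

  LeafOf⇒deg≤1 : ∀ {H v} → LeafOf H v → degree H v ≤ 1
  LeafOf⇒deg≤1 {H} {v} (_ , e , e∈ , i , ¬loop , only) = ≤-trans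
    (deg-mono {E H} {⁅ e ⁆} (λ f∈ j → subst (_∈ ⁅ e ⁆) (sym (only f∈ j)) (x∈⁅x⁆ e)))
    (one i)
    where
    one : Incident v e → deg ⁅ e ⁆ v ≤ 1
    one (inj₁ refl) rewrite deg-⁅⁆ e v | δ-refl v | δ-≢ {tgt e} {src e} (λ l → ¬loop (sym l)) = ≤-refl
    one (inj₂ refl) rewrite deg-⁅⁆ e v | δ-refl v | δ-≢ {src e} {tgt e} ¬loop = ≤-refl

  -- A search over the finitely many edges turns the negative `¬ LeafOf` into a witness: if it
  -- failed, `e` would make `v` a leaf.
  another-edge : ∀ {H v e} → ¬ LeafOf H v → e ∈ E H → Incident v e → ¬ Loop e →
                 ∃[ f ] (f ∈ E H × Incident v f × f ≢ e)
  another-edge {H} {v} {e} ¬leaf e∈ i ¬loop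
    with any? (λ f → f ∈? E H ×-dec incident? v f ×-dec ¬? (f ≟ e))
  ... | yes found = found
  ... | no none   = contradiction
    (Incident⇒∈V H e∈ i , e , e∈ , i , ¬loop , λ {f} → only {f}) ¬leaf
    where
    only : ∀ {f} → f ∈ E H → Incident v f → f ≡ e
    only {f} f∈ j with f ≟ e
    ... | yes f≡e = f≡e
    ... | no f≢e  = contradiction (f , f∈ , j , f≢e) none

  incident-edge : ∀ {H v} → ¬ IsolatedIn H v → v ∈ V H → ∃[ e ] (e ∈ E H × Incident v e)
  incident-edge {H} {v} ¬iso v∈ with any? (λ e → e ∈? E H ×-dec incident? v e)
  ... | yes found = found
  ... | no none   = contradiction (v∈ , λ {e} e∈ i → none (e , e∈ , i)) ¬iso

  -- Some edge meets `v`. If it is a loop it counts twice; otherwise `v`, not being a leaf, has a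
  -- second edge.
  2≤deg : ∀ {H v} → ¬ IsolatedIn H v → ¬ LeafOf H v → v ∈ V H → 2 ≤ degree H v
  2≤deg {H} {v} ¬iso ¬leaf v∈ with incident-edge {H} ¬iso v∈
  ... | e , e∈ , i with Incident⇒Joins i
  ... | u , j with u ≟ v
  ... | yes refl = ≤-trans two (deg-mono {⁅ e ⁆} {E H}
          (λ f∈ _ → ⁅⁆⊆ e∈ f∈))
    where
    two : 2 ≤ deg ⁅ e ⁆ v
    two rewrite deg-joins j v | δ-refl v = ≤-refl
  ... | no u≢v with another-edge {H} ¬leaf e∈ i (Joins-≢⇒¬Loop j (u≢v ∘ sym))
  ... | f , f∈ , k , f≢e = ≤-trans (≤-trans
          (+-mono-≤ (deg-pos⁺ (x∈⁅x⁆ e) i) (deg-pos⁺ (x∈⁅x⁆ f) k))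
          (≤-reflexive (sym (deg-∪ e#f v))))
        (deg-mono {⁅ e ⁆ ∪ ⁅ f ⁆} {E H} (λ g∈ _ → [ ⁅⁆⊆ e∈ , ⁅⁆⊆ f∈ ]′ (x∈p∪q⁻ ⁅ e ⁆ ⁅ f ⁆ g∈)))
    where
    e#f : Disjoint ⁅ e ⁆ ⁅ f ⁆
    e#f x∈ x∈′ = f≢e (trans (sym (x∈⁅y⁆⇒x≡y f x∈′)) (x∈⁅y⁆⇒x≡y e x∈))

  -- Walks and connectedness

  start∈ : ∀ {H : Subgraph G} {u v} (w : Walk H u v) → u List.∈ vertices w
  start∈ ε       = here refl
  start∈ (_ ◅ _) = here refl

  end∈ : ∀ {H : Subgraph G} {u v} (w : Walk H u v) → v List.∈ vertices w
  end∈ ε       = here refl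
  end∈ (_ ◅ w) = there (end∈ w)

  walk-edges⊆ : ∀ {H : Subgraph G} {u v e} (w : Walk H u v) → e List.∈ edges w → e ∈ E H
  walk-edges⊆ (s ◅ _) (here refl) = Step.edge∈ s
  walk-edges⊆ (_ ◅ w) (there e∈)  = walk-edges⊆ w e∈

  walk-edge-ends : ∀ {H : Subgraph G} {u v e x} (w : Walk H u v) →
                   e List.∈ edges w → Incident x e → x List.∈ vertices w
  walk-edge-ends (step e _ j ◅ w) (here refl) i with Incident-Joins j i
  ... | inj₁ refl = here refl
  ... | inj₂ refl = there (start∈ w)
  walk-edge-ends (_ ◅ w) (there e∈) i = there (walk-edge-ends w e∈ i)

  walk-vertices⊆ : ∀ {H : Subgraph G} {u v x} → u ∈ V H → (w : Walk H u v) →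
                   x List.∈ vertices w → x ∈ V H
  walk-vertices⊆ u∈ ε (here refl) = u∈
  walk-vertices⊆ u∈ (_ ◅ _) (here refl) = u∈
  walk-vertices⊆ {H} _ (step e e∈ j ◅ w) (there x∈) =
    walk-vertices⊆ (Incident⇒∈V H e∈ (Joins⇒Incidentˡ (Joins-sym j))) w x∈

  suffix : ∀ {H : Subgraph G} {u v x} (w : Walk H u v) → x List.∈ vertices w → Walk H x v
  suffix ε       (here refl) = ε
  suffix (s ◅ w) (here refl) = s ◅ w
  suffix (_ ◅ w) (there x∈)  = suffix w x∈

  reverseʷ : ∀ {H : Subgraph G} {u v} → Walk H u v → Walk H v u
  reverseʷ = reverse (λ (step e e∈ j) → step e e∈ (Joins-sym j))

  -- `Walk` is indexed by its subgraph, so a walk found in a large graph has to be rebuilt inside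
  -- the piece cut out along it.
  lift : ∀ {H K : Subgraph G} {u v} (w : Walk H u v) →
         (∀ {e} → e List.∈ edges w → e ∈ E K) → Walk K u v
  lift ε                _ = ε
  lift (step e _ j ◅ w) ⊆K = step e (⊆K (here refl)) j ◅ lift w (⊆K ∘ there)

  vertices-lift : ∀ {H K : Subgraph G} {u v} (w : Walk H u v)
                  (⊆K : ∀ {e} → e List.∈ edges w → e ∈ E K) →
                  vertices (lift {K = K} w ⊆K) ≡ vertices w
  vertices-lift ε       _  = refl
  vertices-lift (_ ◅ w) ⊆K = cong (_ ∷_) (vertices-lift w (⊆K ∘ there))

  edges-lift : ∀ {H K : Subgraph G} {u v} (w : Walk H u v)
               (⊆K : ∀ {e} → e List.∈ edges w → e ∈ E K) →
               edges (lift {K = K} w ⊆K) ≡ edges w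
  edges-lift ε       _  = refl
  edges-lift (_ ◅ w) ⊆K = cong (_ ∷_) (edges-lift w (⊆K ∘ there))

  walk-mono : ∀ {H K : Subgraph G} → E H ⊆ E K → ∀ {u v} → Walk H u v → Walk K u v
  walk-mono H⊆K w = lift w (H⊆K ∘ walk-edges⊆ w)

  hub⇒Connected : ∀ {H : Subgraph G} {h} → h ∈ V H → (∀ {v} → v ∈ V H → Walk H v h) → Connected H
  hub⇒Connected h∈ to-hub = (_ , h∈) , λ u∈ v∈ → to-hub u∈ ◅◅ reverseʷ (to-hub v∈)

  Connected-∪ : ∀ {H K : Subgraph G} {h} → Connected H → Connected K → h ∈ V H → h ∈ V K →
                Connected (H ∪ᴳ K)
  Connected-∪ {H} {K} (_ , wH) (_ , wK) h∈H h∈K = hub⇒Connected (x∈p∪q⁺ (inj₁ h∈H)) to-hub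
    where
    to-hub : ∀ {v} → v ∈ V H ∪ V K → Walk (H ∪ᴳ K) v _
    to-hub v∈ with x∈p∪q⁻ (V H) (V K) v∈
    ... | inj₁ v∈H = walk-mono (p⊆p∪q (E K)) (wH v∈H h∈H)
    ... | inj₂ v∈K = walk-mono (q⊆p∪q (E H) (E K)) (wK v∈K h∈K)

  -- The end of the walk is a hub: each vertex reaches it along the rest of the walk.
  spanned⇒Connected : ∀ {H K : Subgraph G} {u v} (w : Walk H u v) → v ∈ V K →
                      (∀ {x} → x ∈ V K → x List.∈ vertices w) →
                      (∀ {e} → e List.∈ edges w → e ∈ E K) → Connected K
  spanned⇒Connected w v∈ V⊆ ⊆K = hub⇒Connected v∈ λ x∈ →
    suffix (lift w ⊆K) (subst (_ List.∈_) (sym (vertices-lift w ⊆K)) (V⊆ x∈))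

  fresh : ∀ {u : Vertex} {xs} → All (u ≢_) xs → ¬ u List.∈ xs
  fresh u≢ u∈ = All.lookup u≢ u∈ refl

  -- Walks without repeated vertices, and closing them up to cycles

  module _ {H : Subgraph G} where

    walk-size : ∀ {u v} (w : Walk H u v) → Unique (vertices w) →
                ∣ fromList (vertices w) ∣ ≡ suc ∣ fromList (edges w) ∣
    walk-size {u} ε _ = trans (∣⁅x⁆∪p∣ {x = u} ∉⊥) (cong suc (trans (∣⊥∣≡0 nV) (sym (∣⊥∣≡0 nE))))
    walk-size {u} (step e _ j ◅ w) (u∉ ∷ uniq) = trans
      (∣⁅x⁆∪p∣ (fresh u∉ ∘ ∈-fromList⁻ (vertices w)))
      (cong suc (trans (walk-size w uniq) (sym (∣⁅x⁆∪p∣ e∉))))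
      where
      e∉ : e ∉ fromList (edges w)
      e∉ e∈ = fresh u∉ (walk-edge-ends w (∈-fromList⁻ (edges w) e∈) (Joins⇒Incidentˡ j))

    -- Stated as if an extra edge joined the ends, so that all vertices look alike.
    walk-deg : ∀ {u v z} (w : Walk H u v) → Unique (vertices w) → z List.∈ vertices w →
               deg (fromList (edges w)) z + (δ u z + δ v z) ≡ 2
    walk-deg {u} ε _ (here refl) rewrite deg-⊥ u | δ-refl u = refl
    walk-deg {u} {v} {z} (_◅_ {j = t} (step e _ j) w) (u∉ ∷ uniq) z∈ = trans
      (cong (_+ (δ u z + δ v z))
        (trans (deg-∪ (⁅⁆-disjoint e∉) z) (cong (_+ deg F z) (deg-joins j z))))
      (go z∈)
      where
      F = fromList (edges w)
      ∉edges : ∀ {x f} → ¬ x List.∈ vertices w → Incident x f → f ∉ F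
      ∉edges x∉ i f∈ = x∉ (walk-edge-ends w (∈-fromList⁻ (edges w) f∈) i)
      e∉ : e ∉ F
      e∉ = ∉edges (fresh u∉) (Joins⇒Incidentˡ j)
      ≢u : ∀ {x} → x List.∈ vertices w → x ≢ u
      ≢u x∈ refl = fresh u∉ x∈
      go : z List.∈ u ∷ vertices w → δ u z + δ t z + deg F z + (δ u z + δ v z) ≡ 2
      go (here refl)
        rewrite δ-refl u | δ-≢ (≢u (start∈ w)) | δ-≢ (≢u (end∈ w))
              | deg-none {F} {u} (λ f∈ i → ∉edges (fresh u∉) i f∈) = refl
      -- With δ u z = 0, the far end `t` of the first step supplies the term for the start of the
      -- remaining walk: the imagined extra edge now joins `t` and `v`.
      go (there z∈)
        rewrite δ-≢ (≢u z∈ ∘ sym) | +-comm (δ t z) (deg F z) | +-assoc (deg F z) (δ t z) (δ v z)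
        = walk-deg w uniq z∈

    trace : ∀ {u v} → Walk H u v → Subgraph G
    trace w = mkSubgraph (fromList (vertices w)) (fromList (edges w)) λ e∈ →
      let e∈w = ∈-fromList⁻ (edges w) e∈ in
      ∈-fromList⁺ (walk-edge-ends w e∈w (inj₁ refl)) , ∈-fromList⁺ (walk-edge-ends w e∈w (inj₂ refl))

    trace-path : ∀ {u v} (w : Walk H u v) → Unique (vertices w) → u ≢ v → PathBetween (trace w) u v
    trace-path w uniq u≢v = u≢v , lift w ∈-fromList⁺
      , subst Unique (sym (vertices-lift w ∈-fromList⁺)) uniq
      , (λ x∈ → subst (_ List.∈_) (sym (vertices-lift w ∈-fromList⁺)) (∈-fromList⁻ (vertices w) x∈))
      , (λ e∈ → subst (_ List.∈_) (sym (edges-lift w ∈-fromList⁺)) (∈-fromList⁻ (edges w) e∈))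

    module _ {u v} (w : Walk H u v) {f} (j : Joins f v u) where

      -- The empty walk closes up to a loop, and a single step to two parallel edges. Below, `f∉`
      -- excludes going back along the same edge.
      closeUp : Subgraph G
      closeUp = mkSubgraph (fromList (vertices w)) (⁅ f ⁆ ∪ fromList (edges w)) λ e∈ →
        let ends = ends⊆ (x∈p∪q⁻ ⁅ f ⁆ (fromList (edges w)) e∈) in
        ∈-fromList⁺ (ends (inj₁ refl)) , ∈-fromList⁺ (ends (inj₂ refl))
        where
        ends⊆ : ∀ {e} → e ∈ ⁅ f ⁆ ⊎ e ∈ fromList (edges w) → ∀ {x} → Incident x e → x List.∈ vertices w
        ends⊆ (inj₁ e∈) i with x∈⁅y⁆⇒x≡y f e∈
        ... | refl with Incident-Joins j i
        ... | inj₁ refl = end∈ w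
        ... | inj₂ refl = start∈ w
        ends⊆ (inj₂ e∈) i = walk-edge-ends w (∈-fromList⁻ (edges w) e∈) i

      module _ (uniq : Unique (vertices w)) (f∉ : ¬ f List.∈ edges w) where

        private
          f∉′ : f ∉ fromList (edges w)
          f∉′ = f∉ ∘ ∈-fromList⁻ (edges w)

        closeUp-IsCycle : IsCycle closeUp
        closeUp-IsCycle = spanned⇒Connected w (∈-fromList⁺ (end∈ w)) (∈-fromList⁻ (vertices w))
                            (λ e∈ → x∈p∪q⁺ (inj₂ (∈-fromList⁺ e∈)))
          , λ {z} z∈ → trans (closeUp-deg z) (walk-deg w uniq (∈-fromList⁻ (vertices w) z∈))
          where
          F = fromList (edges w)
          closeUp-deg : ∀ z → deg (⁅ f ⁆ ∪ F) z ≡ deg F z + (δ u z + δ v z)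
          closeUp-deg z = begin
            deg (⁅ f ⁆ ∪ F) z            ≡⟨ deg-∪ (⁅⁆-disjoint f∉′) z ⟩
            deg ⁅ f ⁆ z + deg F z        ≡⟨ +-comm (deg ⁅ f ⁆ z) (deg F z) ⟩
            deg F z + deg ⁅ f ⁆ z        ≡⟨ cong (λ k → deg F z + k) (deg-joins (Joins-sym j) z) ⟩
            deg F z + (δ u z + δ v z)    ∎
            where open ≡-Reasoning

        closeUp-size : ∣ E closeUp ∣ ≡ ∣ V closeUp ∣
        closeUp-size = trans (∣⁅x⁆∪p∣ f∉′) (sym (walk-size w uniq))

  -- Sizes and degrees of paths

  module _ {P : Subgraph G} {x y} (path : PathBetween P x y) where

    private
      x≢y = proj₁ path
      w = proj₁ (proj₂ path)
      uniq = proj₁ (proj₂ (proj₂ path))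
      V⊆ = proj₁ (proj₂ (proj₂ (proj₂ path)))
      E⊆ = proj₂ (proj₂ (proj₂ (proj₂ path)))

    path-start∈ : x ∈ V P
    path-start∈ with w
    ... | ε = contradiction refl x≢y
    ... | step e e∈ j ◅ _ = Incident⇒∈V P e∈ (Joins⇒Incidentˡ j)

    path-end∈ : y ∈ V P
    path-end∈ = walk-vertices⊆ path-start∈ w (end∈ w)

    private
      -- `PathBetween` asks that the walk cover `P`; the other inclusion holds because it is a walk
      -- in `P`.
      E≡ : E P ≡ fromList (edges w)
      E≡ = ⊆-antisym (∈-fromList⁺ ∘ E⊆) (walk-edges⊆ w ∘ ∈-fromList⁻ (edges w))

      V≡ : V P ≡ fromList (vertices w)
      V≡ = ⊆-antisym (∈-fromList⁺ ∘ V⊆) (walk-vertices⊆ path-start∈ w ∘ ∈-fromList⁻ (vertices w))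

    path-size : ∣ V P ∣ ≡ suc ∣ E P ∣
    path-size = trans (cong ∣_∣ V≡) (trans (walk-size w uniq) (cong (suc ∘ ∣_∣) (sym E≡)))

    path-deg : ∀ {z} → z ∈ V P → degree P z + (δ x z + δ y z) ≡ 2
    path-deg {z} z∈ = trans (cong (λ F → deg F z + (δ x z + δ y z)) E≡) (walk-deg w uniq (V⊆ z∈))

    path-deg-start : degree P x ≡ 1
    path-deg-start with eq ← path-deg path-start∈
      rewrite δ-refl x | δ-≢ (x≢y ∘ sym) = suc-injective (trans (+-comm 1 _) eq)

    path-deg-end : degree P y ≡ 1
    path-deg-end with eq ← path-deg path-end∈
      rewrite δ-refl y | δ-≢ x≢y = suc-injective (trans (+-comm 1 _) eq)

    path-deg-inner : ∀ {z} → z ∈ V P → z ≢ x → z ≢ y → degree P z ≡ 2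
    path-deg-inner {z} z∈ z≢x z≢y with eq ← path-deg z∈
      rewrite δ-≢ (z≢x ∘ sym) | δ-≢ (z≢y ∘ sym) = trans (sym (+-identityʳ _)) eq

    path-connected : Connected P
    path-connected = spanned⇒Connected w path-end∈ V⊆ (walk-edges⊆ w)

  -- Sizes and degrees of lollipops

  module _ {Q : Subgraph G} {x} (lollipop : LollipopWithEnd Q x) where

    private
      C = proj₁ lollipop
      P = proj₁ (proj₂ lollipop)
      y = proj₁ (proj₂ (proj₂ lollipop))
      cycle = proj₁ (proj₂ (proj₂ (proj₂ lollipop)))
      path = proj₁ (proj₂ (proj₂ (proj₂ (proj₂ lollipop))))
      C∩P≡⁅y⁆ = proj₁ (proj₂ (proj₂ (proj₂ (proj₂ (proj₂ lollipop)))))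
      Q≋C∪P = proj₂ (proj₂ (proj₂ (proj₂ (proj₂ (proj₂ lollipop)))))

      ≡y : ∀ {z} → z ∈ V C → z ∈ V P → z ≡ y
      ≡y z∈C z∈P = x∈⁅y⁆⇒x≡y y (subst (_ ∈_) C∩P≡⁅y⁆ (x∈p∩q⁺ (z∈C , z∈P)))

      y∈C : y ∈ V C
      y∈C = proj₁ (x∈p∩q⁻ (V C) (V P) (subst (y ∈_) (sym C∩P≡⁅y⁆) (x∈⁅x⁆ y)))

      x∉C : x ∉ V C
      x∉C x∈C = proj₁ path (sym (≡y x∈C (path-end∈ path)))

      -- A common edge would be a loop at `y`, but `y` has degree 1 in the path.
      edges-disjoint : Disjoint (E C) (E P)
      edges-disjoint {e} e∈C e∈P = contradiction two≤ (≤⇒≯ (≤-reflexive (path-deg-start path)))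
        where
        end≡y : ∀ {z} → Incident z e → z ≡ y
        end≡y i = ≡y (Incident⇒∈V C e∈C i) (Incident⇒∈V P e∈P i)
        loop : Joins e y y
        loop = inj₁ (end≡y (inj₁ refl) , end≡y (inj₂ refl))
        two : deg ⁅ e ⁆ y ≡ 2
        two = trans (deg-joins loop y) (cong₂ _+_ (δ-refl y) (δ-refl y))
        two≤ : 2 ≤ degree P y
        two≤ = ≤-trans (≤-reflexive (sym two)) (deg-mono {⁅ e ⁆} {E P}
          (λ f∈ _ → ⁅⁆⊆ e∈P f∈))

      Q-deg : ∀ z → degree Q z ≡ degree C z + degree P z
      Q-deg z = trans (cong (λ F → deg F z) (proj₂ Q≋C∪P)) (deg-∪ edges-disjoint z)

    lollipop-E-size : ∣ E Q ∣ ≡ ∣ E C ∣ + ∣ E P ∣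
    lollipop-E-size = trans (cong ∣_∣ (proj₂ Q≋C∪P)) (∣∪∣-disjoint edges-disjoint)

    lollipop-V-size : suc ∣ V Q ∣ ≡ ∣ V C ∣ + ∣ V P ∣
    lollipop-V-size = begin
      suc ∣ V Q ∣                        ≡⟨ cong (suc ∘ ∣_∣) (proj₁ Q≋C∪P) ⟩
      suc ∣ V C ∪ V P ∣                  ≡⟨ +-comm 1 _ ⟩
      ∣ V C ∪ V P ∣ + 1                  ≡⟨ cong (λ k → ∣ V C ∪ V P ∣ + k) one ⟨
      ∣ V C ∪ V P ∣ + ∣ V C ∩ V P ∣      ≡⟨ ∣p∪q∣+∣p∩q∣≡∣p∣+∣q∣ (V C) (V P) ⟩
      ∣ V C ∣ + ∣ V P ∣                  ∎
      where
      open ≡-Reasoning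
      one : ∣ V C ∩ V P ∣ ≡ 1
      one = trans (cong ∣_∣ C∩P≡⁅y⁆) (∣⁅x⁆∣≡1 y)

    lollipop-deg-end : degree Q x ≡ 1
    lollipop-deg-end = trans (Q-deg x) (cong₂ _+_
      (deg-none {E C} (λ e∈ i → x∉C (Incident⇒∈V C e∈ i))) (path-deg-end path))

    lollipop-end∈ : x ∈ V Q
    lollipop-end∈ = subst (x ∈_) (sym (proj₁ Q≋C∪P)) (x∈p∪q⁺ (inj₂ (path-end∈ path)))

    -- The cycle alone gives degree 2 to its vertices, among them the junction `y`, whose degree in
    -- the path is only 1. Any other vertex is interior to the path.
    lollipop-deg-other : ∀ {z} → z ∈ V Q → z ≢ x → 2 ≤ degree Q z
    lollipop-deg-other {z} z∈ z≢x rewrite Q-deg z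
      with x∈p∪q⁻ (V C) (V P) (subst (z ∈_) (proj₁ Q≋C∪P) z∈) | z ≟ y
    ... | inj₁ z∈C | _        = ≤-trans (≤-reflexive (sym (proj₂ cycle z∈C))) (m≤m+n _ _)
    ... | inj₂ _   | yes refl = ≤-trans (≤-reflexive (sym (proj₂ cycle y∈C))) (m≤m+n _ _)
    ... | inj₂ z∈P | no z≢y   =
      ≤-trans (≤-reflexive (sym (path-deg-inner path z∈P z≢y z≢x))) (m≤n+m _ (degree C z))

  -- Splitting walks, and ears

  -- Made for lollipops: when a trail runs into its own vertex `t`, `before` closes up to the cycle
  -- and `after` is the stick; `common` says that they share only `t`.
  record Split {H : Subgraph G} {u v} (w : Walk H u v) (t : Vertex) : Set where
    field
      before        : Walk H u t
      after         : Walk H t v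
      unique-before : Unique (vertices before)
      unique-after  : Unique (vertices after)
      V-before      : ∀ {x} → x List.∈ vertices before → x List.∈ vertices w
      V-after       : ∀ {x} → x List.∈ vertices after → x List.∈ vertices w
      E-before      : ∀ {e} → e List.∈ edges before → e List.∈ edges w
      E-after       : ∀ {e} → e List.∈ edges after → e List.∈ edges w
      common        : ∀ {x} → x List.∈ vertices before → x List.∈ vertices after → x ≡ t

  split-start : ∀ {H : Subgraph G} {u v} (w : Walk H u v) → Unique (vertices w) → Split w u
  split-start w uniq = record
    { before = ε ; after = w ; unique-before = All.[] ∷ [] ; unique-after = uniq
    ; V-before = λ { (here refl) → start∈ w } ; V-after = λ x∈ → x∈
    ; E-before = λ () ; E-after = λ e∈ → e∈ ; common = λ { (here refl) _ → refl } }

  split : ∀ {H : Subgraph G} {u v t} (w : Walk H u v) → Unique (vertices w) →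
          t List.∈ vertices w → Split w t
  split ε       uniq (here refl) = split-start ε uniq
  split (s ◅ w) uniq (here refl) = split-start (s ◅ w) uniq
  split (s ◅ w) (u∉ ∷ uniq) (there t∈) = record
    { before        = s ◅ before
    ; after         = after
    ; unique-before = All.tabulate (λ x∈ → All.lookup u∉ (V-before x∈)) ∷ unique-before
    ; unique-after  = unique-after
    ; V-before      = λ { (here refl) → here refl ; (there x∈) → there (V-before x∈) }
    ; V-after       = there ∘ V-after
    ; E-before      = λ { (here refl) → here refl ; (there e∈) → there (E-before e∈) }
    ; E-after       = there ∘ E-after
    ; common        = λ { (here refl) x∈ → contradiction (V-after x∈) (fresh u∉)
                        ; (there x∈) x∈′ → common x∈ x∈′ } }
    where open Split (split w uniq t∈)

  data Ear (K : Subgraph G) : Subgraph G → Set where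
    path     : ∀ {P x y} → PathBetween P x y → V K ∩ V P ≡ ⁅ x ⁆ ∪ ⁅ y ⁆ → Ear K P
    cycle    : ∀ {P x} → IsCycle P → ∣ E P ∣ ≡ ∣ V P ∣ → V K ∩ V P ≡ ⁅ x ⁆ → Ear K P
    lollipop : ∀ {C P x y} → IsCycle C → ∣ E C ∣ ≡ ∣ V C ∣ → PathBetween P y x →
               V C ∩ V P ≡ ⁅ y ⁆ → V K ∩ (V C ∪ V P) ≡ ⁅ x ⁆ → Ear K (C ∪ᴳ P)

  ∈-∩-⁅⁆ : ∀ {n} {p q : Subset n} {x} → p ∩ q ≡ ⁅ x ⁆ → x ∈ p × x ∈ q
  ∈-∩-⁅⁆ {p = p} {q} {x} eq = x∈p∩q⁻ p q (subst (x ∈_) (sym eq) (x∈⁅x⁆ x))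

  ≡⁅⁆ : ∀ {n} {p q : Subset n} {x} → x ∈ p → x ∈ q → (∀ {z} → z ∈ p → z ∈ q → z ≡ x) → p ∩ q ≡ ⁅ x ⁆
  ≡⁅⁆ {p = p} {q} {x} x∈p x∈q only = ⊆-antisym
    (λ z∈ → let z∈p , z∈q = x∈p∩q⁻ p q z∈ in subst (_∈ ⁅ x ⁆) (sym (only z∈p z∈q)) (x∈⁅x⁆ x))
    (λ z∈ → subst (_∈ p ∩ q) (sym (x∈⁅y⁆⇒x≡y x z∈)) (x∈p∩q⁺ (x∈p , x∈q)))

  ear-lollipop : ∀ (C P : Subgraph G) {x y} → IsCycle C → PathBetween P y x → V C ∩ V P ≡ ⁅ y ⁆ →
                 LollipopWithEnd (C ∪ᴳ P) x
  ear-lollipop C P c p C∩P = C , P , _ , c , p , C∩P , refl , refl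

  lollipop-size : ∀ {C P : Subgraph G} {x y} → IsCycle C → ∣ E C ∣ ≡ ∣ V C ∣ → PathBetween P y x →
                  V C ∩ V P ≡ ⁅ y ⁆ → ∣ E C ∪ E P ∣ ≡ ∣ V C ∪ V P ∣
  lollipop-size {C} {P} c size p C∩P = suc-injective (begin
    suc ∣ E C ∪ E P ∣          ≡⟨ cong suc (lollipop-E-size {C ∪ᴳ P} (ear-lollipop C P c p C∩P)) ⟩
    suc (∣ E C ∣ + ∣ E P ∣)    ≡⟨ +-suc ∣ E C ∣ ∣ E P ∣ ⟨
    ∣ E C ∣ + suc ∣ E P ∣      ≡⟨ cong₂ _+_ size (sym (path-size p)) ⟩
    ∣ V C ∣ + ∣ V P ∣          ≡⟨ lollipop-V-size {C ∪ᴳ P} (ear-lollipop C P c p C∩P) ⟨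
    suc ∣ V C ∪ V P ∣          ∎)
    where open ≡-Reasoning

  module _ {K : Subgraph G} where

    -- Inside a union, shared vertices are not new, so this says that `P` brings one more new edge
    -- than new vertices, provided its edges are new.
    ear-size : ∀ {P} → Ear K P → ∣ E P ∣ + ∣ V K ∩ V P ∣ ≡ suc ∣ V P ∣
    ear-size {P} (path {x = x} {y} p K∩P) = begin
      ∣ E P ∣ + ∣ V K ∩ V P ∣      ≡⟨ cong (λ q → ∣ E P ∣ + ∣ q ∣) K∩P ⟩
      ∣ E P ∣ + ∣ ⁅ x ⁆ ∪ ⁅ y ⁆ ∣  ≡⟨ cong (λ k → ∣ E P ∣ + k) two ⟩
      ∣ E P ∣ + 2                  ≡⟨ +-comm _ 2 ⟩
      suc (suc ∣ E P ∣)            ≡⟨ cong suc (path-size p) ⟨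
      suc ∣ V P ∣                  ∎
      where
      open ≡-Reasoning
      two : ∣ ⁅ x ⁆ ∪ ⁅ y ⁆ ∣ ≡ 2
      two = trans (∣⁅x⁆∪p∣ (proj₁ p ∘ x∈⁅y⁆⇒x≡y y)) (cong suc (∣⁅x⁆∣≡1 y))
    ear-size {P} (cycle {x = x} _ size K∩P) = trans
      (cong₂ _+_ size (trans (cong ∣_∣ K∩P) (∣⁅x⁆∣≡1 x))) (+-comm _ 1)
    ear-size (lollipop {x = x} c size p C∩P K∩Q) = trans
      (cong₂ _+_ (lollipop-size c size p C∩P) (trans (cong ∣_∣ K∩Q) (∣⁅x⁆∣≡1 x))) (+-comm _ 1)

    ear-connected : ∀ {P} → Ear K P → Connected P
    ear-connected (path p _) = path-connected p
    ear-connected (cycle c _ _) = proj₁ c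
    ear-connected (lollipop {C} {P} c _ p C∩P _) =
      let y∈C , y∈P = ∈-∩-⁅⁆ C∩P in Connected-∪ (proj₁ c) (path-connected p) y∈C y∈P

    -- The common vertex links `P` to `K`. When `K` is a cycle, the positive degree in `P` lifts its
    -- degree to at least 3.
    ear-anchor : ∀ {P} → Ear K P → ∃[ x ] (x ∈ V K × x ∈ V P × 1 ≤ degree P x)
    ear-anchor {P} (path {x = x} {y} p K∩P) =
      let x∈K , x∈P = x∈p∩q⁻ (V K) (V P) (subst (x ∈_) (sym K∩P) (p⊆p∪q ⁅ y ⁆ (x∈⁅x⁆ x))) in
      x , x∈K , x∈P , ≤-reflexive (sym (path-deg-start p))
    ear-anchor (cycle {x = x} c _ K∩P) =
      let x∈K , x∈P = ∈-∩-⁅⁆ K∩P in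
      x , x∈K , x∈P , ≤-trans (s≤s z≤n) (≤-reflexive (sym (proj₂ c x∈P)))
    ear-anchor (lollipop {C} {P} {x} c _ p C∩P K∩Q) =
      let x∈K , x∈Q = ∈-∩-⁅⁆ K∩Q in
      x , x∈K , x∈Q , ≤-reflexive (sym (lollipop-deg-end {C ∪ᴳ P} (ear-lollipop C P c p C∩P)))

    -- Only the ends of a path or lollipop have degree 1, and these lie in `K`.
    ear-deg : ∀ {P z} → Ear K P → z ∈ V P → z ∉ V K → 2 ≤ degree P z
    ear-deg {P} {z} (path {x = x} {y} p K∩P) z∈P z∉K =
      ≤-reflexive (sym (path-deg-inner p z∈P
        (λ { refl → z∉K (ends⊆K (p⊆p∪q ⁅ y ⁆ (x∈⁅x⁆ x))) })
        (λ { refl → z∉K (ends⊆K (q⊆p∪q ⁅ x ⁆ ⁅ y ⁆ (x∈⁅x⁆ y))) })))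
      where
      ends⊆K : ⁅ x ⁆ ∪ ⁅ y ⁆ ⊆ V K
      ends⊆K e∈ = proj₁ (x∈p∩q⁻ (V K) (V P) (subst (_ ∈_) (sym K∩P) e∈))
    ear-deg (cycle c _ _) z∈P _ = ≤-reflexive (sym (proj₂ c z∈P))
    ear-deg (lollipop {C} {P} c _ p C∩P K∩Q) z∈Q z∉K =
      lollipop-deg-other {C ∪ᴳ P} (ear-lollipop C P c p C∩P) z∈Q λ { refl → z∉K (proj₁ (∈-∩-⁅⁆ K∩Q)) }

  -- Greedy search for an ear

  -- Oriented from the growing head `u` back to the base `v` in `K`, so that one more edge is one
  -- more `◅`.
  record Trail (M K : Subgraph G) (u v : Vertex) : Set where
    field
      walk   : Walk M u v
      unique : Unique (vertices walk)
      head∈M : u ∈ V M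
      base∈K : v ∈ V K
      meets  : ∀ {x} → x List.∈ vertices walk → x ∈ V K → x ≡ v
      avoids : ∀ {e} → e List.∈ edges walk → e ∉ E K

  EarIn : Subgraph G → Subgraph G → Set
  EarIn M K = ∃[ P ] (Ear K P × P ⊑ M × Disjoint (E P) (E K))

  module _ {M K : Subgraph G} {u v} (T : Trail M K u v) where
    open Trail T

    private
      V⊆M : ∀ {x} → x List.∈ vertices walk → x ∈ V M
      V⊆M = walk-vertices⊆ head∈M walk

    module _ {t f} (f∈M : f ∈ E M) (f∉K : f ∉ E K) (j : Joins f t u) where

      private
        ≡f : ∀ {e} → e ∈ ⁅ f ⁆ → e ≡ f
        ≡f = x∈⁅y⁆⇒x≡y f

        t∈M : t ∈ V M
        t∈M = Incident⇒∈V M f∈M (Joins⇒Incidentˡ j)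

      path-ear : t ∈ V K → t ≢ v → EarIn M K
      path-ear t∈K t≢v = trace w , path (trace-path w (t∉ ∷ unique) t≢v) K∩P
        , ( (λ x∈ → walk-vertices⊆ t∈M w (∈-fromList⁻ (vertices w) x∈))
          , (λ e∈ → walk-edges⊆ w (∈-fromList⁻ (edges w) e∈)))
        , λ e∈ → outside (∈-fromList⁻ (edges w) e∈)
        where
        w = step f f∈M j ◅ walk
        -- A vertex of the trail lying in `K` could only be the base.
        t∉ : All (t ≢_) (vertices walk)
        t∉ = All.tabulate λ { x∈ refl → t≢v (meets x∈ t∈K) }
        outside : ∀ {e} → e List.∈ edges w → e ∉ E K
        outside (here refl) = f∉K
        outside (there e∈)  = avoids e∈
        ends : ∀ {x} → x List.∈ vertices w → x ∈ V K → x ∈ ⁅ t ⁆ ∪ ⁅ v ⁆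
        ends (here refl) _   = p⊆p∪q ⁅ v ⁆ (x∈⁅x⁆ t)
        ends (there x∈)  x∈K = q⊆p∪q ⁅ t ⁆ ⁅ v ⁆ (subst (_∈ ⁅ v ⁆) (sym (meets x∈ x∈K)) (x∈⁅x⁆ v))
        ends⁻ : ∀ {x} → x ∈ ⁅ t ⁆ ⊎ x ∈ ⁅ v ⁆ → x ∈ V K × x List.∈ vertices w
        ends⁻ (inj₁ x∈) with refl ← x∈⁅y⁆⇒x≡y t x∈ = t∈K , here refl
        ends⁻ (inj₂ x∈) with refl ← x∈⁅y⁆⇒x≡y v x∈ = base∈K , there (end∈ walk)
        K∩P : V K ∩ fromList (vertices w) ≡ ⁅ t ⁆ ∪ ⁅ v ⁆
        K∩P = ⊆-antisym
          (λ x∈ → let x∈K , x∈w = x∈p∩q⁻ (V K) _ x∈ in ends (∈-fromList⁻ (vertices w) x∈w) x∈K)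
          (λ x∈ → let x∈K , x∈w = ends⁻ (x∈p∪q⁻ ⁅ t ⁆ ⁅ v ⁆ x∈) in x∈p∩q⁺ (x∈K , ∈-fromList⁺ x∈w))

      module _ (f∉ : ¬ f List.∈ edges walk) where

        cycle-ear : t ≡ v → EarIn M K
        cycle-ear refl = closeUp walk j
          , cycle (closeUp-IsCycle walk j unique f∉) (closeUp-size walk j unique f∉)
              (≡⁅⁆ base∈K (∈-fromList⁺ (end∈ walk))
                (λ x∈K x∈w → meets (∈-fromList⁻ (vertices walk) x∈w) x∈K))
          , ( (λ x∈ → V⊆M (∈-fromList⁻ (vertices walk) x∈))
            , (λ e∈ → proj₁ (sides (x∈p∪q⁻ ⁅ f ⁆ _ e∈))))
          , λ e∈ → proj₂ (sides (x∈p∪q⁻ ⁅ f ⁆ _ e∈))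
          where
          sides : ∀ {e} → e ∈ ⁅ f ⁆ ⊎ e ∈ fromList (edges walk) → e ∈ E M × e ∉ E K
          sides (inj₁ e∈) with refl ← ≡f e∈ = f∈M , f∉K
          sides (inj₂ e∈) = let e∈w = ∈-fromList⁻ (edges walk) e∈ in walk-edges⊆ walk e∈w , avoids e∈w

        lollipop-ear : t ∉ V K → t List.∈ vertices walk → EarIn M K
        lollipop-ear t∉K t∈w = C ∪ᴳ P
          , lollipop (closeUp-IsCycle before j unique-before (f∉ ∘ E-before))
              (closeUp-size before j unique-before (f∉ ∘ E-before))
              (trace-path after unique-after λ { refl → t∉K base∈K })
              (≡⁅⁆ (∈-fromList⁺ (end∈ before)) (∈-fromList⁺ (start∈ after))
                (λ x∈ x∈′ → common (∈-fromList⁻ (vertices before) x∈) (∈-fromList⁻ (vertices after) x∈′)))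
              (≡⁅⁆ base∈K (x∈p∪q⁺ (inj₂ (∈-fromList⁺ (end∈ after))))
                (λ x∈K x∈Q → meets (V⊆ (x∈p∪q⁻ (V C) (V P) x∈Q)) x∈K))
          , ( (λ x∈ → V⊆M (V⊆ (x∈p∪q⁻ (V C) (V P) x∈)))
            , (λ e∈ → proj₁ (sides (x∈p∪q⁻ (E C) (E P) e∈))))
          , λ e∈ → proj₂ (sides (x∈p∪q⁻ (E C) (E P) e∈))
          where
          open Split (split walk unique t∈w)
          C = closeUp before j
          P = trace after
          V⊆ : ∀ {x} → x ∈ V C ⊎ x ∈ V P → x List.∈ vertices walk
          V⊆ (inj₁ x∈) = V-before (∈-fromList⁻ (vertices before) x∈)
          V⊆ (inj₂ x∈) = V-after (∈-fromList⁻ (vertices after) x∈)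
          old : ∀ {e} → e List.∈ edges walk → e ∈ E M × e ∉ E K
          old e∈ = walk-edges⊆ walk e∈ , avoids e∈
          sides : ∀ {e} → e ∈ E C ⊎ e ∈ E P → e ∈ E M × e ∉ E K
          sides (inj₂ e∈) = old (E-after (∈-fromList⁻ (edges after) e∈))
          sides (inj₁ e∈) with x∈p∪q⁻ ⁅ f ⁆ (fromList (edges before)) e∈
          ... | inj₁ e∈⁅f⁆ with refl ← ≡f e∈⁅f⁆ = f∈M , f∉K
          ... | inj₂ e∈w = old (E-before (∈-fromList⁻ (edges before) e∈w))

      extend : t ∉ V K → ¬ t List.∈ vertices walk → Trail M K t v
      extend t∉K t∉w = record
        { walk   = step f f∈M j ◅ walk
        ; unique = All.tabulate (λ { x∈ refl → t∉w x∈ }) ∷ unique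
        ; head∈M = t∈M
        ; base∈K = base∈K
        ; meets  = λ { (here refl) x∈K → contradiction x∈K t∉K ; (there x∈) → meets x∈ }
        ; avoids = λ { (here refl) → f∉K ; (there e∈) → avoids e∈ }
        }

  module _ {M K : Subgraph G} (noLeaf : ∀ v → ¬ LeafOf M v) where

    -- Recursion on a bound `k` for the number of vertices not yet visited.
    prolong : ∀ k {u v t f} (T : Trail M K u v) → f ∈ E M → f ∉ E K → Joins f t u →
              ¬ f List.∈ edges (Trail.walk T) →
              nV < k + ∣ fromList (vertices (Trail.walk T)) ∣ → EarIn M K
    prolong k {u} {v} {t} {f} T f∈M f∉K j f∉w bound
      with t ∈? V K | t ≟ v | DecList._∈?_ _≟_ t (vertices (Trail.walk T))
    ... | yes _   | yes t≡v | _       = cycle-ear T f∈M f∉K j f∉w t≡v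
    ... | yes t∈K | no t≢v  | _       = path-ear T f∈M f∉K j t∈K t≢v
    ... | no t∉K  | _       | yes t∈w = lollipop-ear T f∈M f∉K j f∉w t∉K t∈w
    ... | no t∉K  | _       | no t∉w  = next k bound
      where
      T′ = extend T f∈M f∉K j t∉K t∉w
      w = Trail.walk T
      t≢u : t ≢ u
      t≢u refl = t∉w (start∈ w)
      next : ∀ k → nV < k + ∣ fromList (vertices w) ∣ → EarIn M K
      next zero    bound = contradiction bound (≤⇒≯ (∣p∣≤n (fromList (vertices w))))
      next (suc k) bound
        -- As `t` is new it differs from `u`, so `f` is no loop and a second edge `g` exists at `t`.
        -- Since `t` is neither in `K` nor on the trail, neither is `g`.
        with g , g∈M , i , g≢f ← another-edge {M} (noLeaf t) f∈M (Joins⇒Incidentˡ j) (Joins-≢⇒¬Loop j t≢u)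
        with _ , j′ ← Incident⇒Joins i
        = prolong k T′ g∈M (λ g∈K → t∉K (Incident⇒∈V K g∈K i)) (Joins-sym j′)
            (λ { (here g≡f) → g≢f g≡f ; (there g∈w) → t∉w (walk-edge-ends w g∈w i) })
            (subst (nV <_) (sym (trans (cong (k +_) (∣⁅x⁆∪p∣ (t∉w ∘ ∈-fromList⁻ (vertices w))))
                                       (+-suc k _))) bound)

    attach-ear : ∀ {v e} → v ∈ V K → e ∈ E M → e ∉ E K → Incident v e → EarIn M K
    attach-ear {v} v∈K e∈M e∉K i with _ , j ← Incident⇒Joins i =
      prolong (suc nV) T e∈M e∉K (Joins-sym j) (λ ()) (s≤s (m≤m+n nV _))
      where
      T : Trail M K v v
      T = record
        { walk = ε ; unique = All.[] ∷ [] ; head∈M = Incident⇒∈V M e∈M i ; base∈K = v∈K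
        ; meets = λ { (here refl) _ → refl } ; avoids = λ () }

  -- Edge and vertex counts of a union

  -- The hypothesis is Δ(H ∪ P) = Δ(H) + 1 cleared of subtraction. As vertices are not lost, edges
  -- must be gained.
  ∣E∣<∣E∪E∣ : ∀ {H P : Subgraph G} → ∣ E H ∪ E P ∣ + ∣ V H ∣ ≡ suc (∣ V H ∪ V P ∣ + ∣ E H ∣) →
              ∣ E H ∣ < ∣ E H ∪ E P ∣
  ∣E∣<∣E∪E∣ {H} {P} eq = +-cancelʳ-≤ (∣ V H ∣) _ _ (begin
    suc ∣ E H ∣ + ∣ V H ∣          ≤⟨ +-monoʳ-≤ (suc ∣ E H ∣) (∣p∣≤∣p∪q∣ (V H) (V P)) ⟩
    suc ∣ E H ∣ + ∣ V H ∪ V P ∣    ≡⟨ cong suc (+-comm ∣ E H ∣ _) ⟩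
    suc (∣ V H ∪ V P ∣ + ∣ E H ∣)  ≡⟨ eq ⟨
    ∣ E H ∪ E P ∣ + ∣ V H ∣        ∎)
    where open ≤-Reasoning

  -- Edge counts add and vertex counts obey inclusion-exclusion; the size of the intersection is
  -- added to both sides and cancelled at the end.
  ∪-size : ∀ {K P : Subgraph G} → Disjoint (E P) (E K) →
           ∣ E P ∣ + ∣ V K ∩ V P ∣ ≡ suc ∣ V P ∣ →
           ∣ E K ∪ E P ∣ + ∣ V K ∣ ≡ suc (∣ V K ∪ V P ∣ + ∣ E K ∣)
  ∪-size {K} {P} P#K size = +-cancelʳ-≡ i _ _ (begin
    ∣ E K ∪ E P ∣ + vK + i           ≡⟨ cong (λ e → e + vK + i)
                                          (∣∪∣-disjoint (λ x∈K x∈P → P#K x∈P x∈K)) ⟩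
    eK + eP + vK + i                 ≡⟨ solve 4 (λ a b c d → a :+ b :+ c :+ d := a :+ c :+ (b :+ d))
                                        refl eK eP vK i ⟩
    eK + vK + (eP + i)               ≡⟨ cong (λ k → eK + vK + k) size ⟩
    eK + vK + suc vP                 ≡⟨ solve 3 (λ a b c → a :+ b :+ (con 1 :+ c) := con 1 :+ a :+ (b :+ c))
                                        refl eK vK vP ⟩
    suc eK + (vK + vP)               ≡⟨ cong (λ k → suc eK + k) (∣p∪q∣+∣p∩q∣≡∣p∣+∣q∣ (V K) (V P)) ⟨
    suc eK + (∣ V K ∪ V P ∣ + i)     ≡⟨ solve 3 (λ a b c → con 1 :+ a :+ (b :+ c) := con 1 :+ (b :+ a) :+ c)
                                        refl eK (∣ V K ∪ V P ∣) i ⟩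
    suc (∣ V K ∪ V P ∣ + eK) + i     ∎)
    where
    open ≡-Reasoning
    open +-*-Solver
    eK = ∣ E K ∣
    eP = ∣ E P ∣
    vK = ∣ V K ∣
    vP = ∣ V P ∣
    i  = ∣ V K ∩ V P ∣

  -- Exits and components

  walk-stays : ∀ {H : Subgraph G} {S : Vertex → Set} →
               (∀ {e u v} → e ∈ E H → Joins e u v → S u → S v) →
               ∀ {u v} → Walk H u v → S u → S v
  walk-stays closed ε                = λ s → s
  walk-stays closed (step _ e∈ j ◅ w) = walk-stays closed w ∘ closed e∈ j

  touches? : ∀ (K : Subgraph G) e → Dec (∃[ v ] (v ∈ V K × Incident v e))
  touches? K e with src e ∈? V K | tgt e ∈? V K
  ... | yes s∈ | _      = yes (src e , s∈ , inj₁ refl)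
  ... | no _   | yes t∈ = yes (tgt e , t∈ , inj₂ refl)
  ... | no s∉  | no t∉  = no λ { (_ , v∈ , inj₁ refl) → s∉ v∈ ; (_ , v∈ , inj₂ refl) → t∉ v∈ }

  -- It is the edge that lies outside `K`: a chord with both ends in `K` counts as well.
  Exit : Subgraph G → Subgraph G → Set
  Exit M K = ∃[ e ] (e ∈ E M × e ∉ E K × ∃[ v ] (v ∈ V K × Incident v e))

  exit? : ∀ M K → Dec (Exit M K)
  exit? M K = any? (λ e → e ∈? E M ×-dec ¬? (e ∈? E K) ×-dec touches? K e)

  no-exit⇒∈E : ∀ {M K} → ¬ Exit M K → ∀ {e v} → e ∈ E M → v ∈ V K → Incident v e → e ∈ E K
  no-exit⇒∈E {M} {K} ¬exit {e} {v} e∈M v∈K i with e ∈? E K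
  ... | yes e∈K = e∈K
  ... | no e∉K  = contradiction (e , e∈M , e∉K , v , v∈K , i) ¬exit

  no-exit⇒closed : ∀ {M K} → ¬ Exit M K → ∀ {e u v} → e ∈ E M → Joins e u v → u ∈ V K → v ∈ V K
  no-exit⇒closed {M} {K} ¬exit e∈M j u∈K = Incident⇒∈V K
    (no-exit⇒∈E {M} {K} ¬exit e∈M u∈K (Joins⇒Incidentˡ j)) (Joins⇒Incidentˡ (Joins-sym j))

  no-exit⇒ComponentOf : ∀ {M K} → K ⊑ M → Connected K → ¬ Exit M K → ComponentOf M K
  no-exit⇒ComponentOf {M} {K} K⊑M conn@((c , c∈K) , _) ¬exit = K⊑M , conn , maximal
    where
    maximal : ∀ K′ → K′ ⊑ M → Connected K′ → K ⊑ K′ → K′ ⊑ K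
    maximal K′ K′⊑M conn′ K⊑K′ = V⊆ ,
      λ {e} e∈ → no-exit⇒∈E {M} {K} ¬exit (proj₂ K′⊑M e∈)
        (V⊆ (Incident⇒∈V K′ e∈ (inj₁ refl))) (inj₁ refl)
      where
      V⊆ : V K′ ⊆ V K
      V⊆ x∈ = walk-stays {K′} (no-exit⇒closed {M} {K} ¬exit ∘ proj₂ K′⊑M)
        (proj₂ conn′ (proj₁ K⊑K′ c∈K) x∈) c∈K

  -- Joining `e` and its ends to `K` keeps it connected, so maximality puts `e` into `K`.
  component-absorbs : ∀ {M K e u} → ComponentOf M K → e ∈ E M → u ∈ V K → Incident u e → e ∈ E K
  component-absorbs {M} {K} {e} {u} (K⊑M , conn , maximal) e∈M u∈K i
    with v , j ← Incident⇒Joins i = proj₂ K∪e⊑K (q⊆p∪q (E K) (E e*) (x∈p∪q⁺ (inj₁ (x∈⁅x⁆ e))))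
    where
    w : Walk M u v
    w = step e e∈M j ◅ ε
    e* = trace w
    e*-connected : Connected e*
    e*-connected = spanned⇒Connected w (∈-fromList⁺ (end∈ w)) (∈-fromList⁻ (vertices w)) ∈-fromList⁺
    V⊆M : ∀ {x} → x ∈ V K ⊎ x ∈ V e* → x ∈ V M
    V⊆M (inj₁ x∈) = proj₁ K⊑M x∈
    V⊆M (inj₂ x∈) = walk-vertices⊆ (proj₁ K⊑M u∈K) w (∈-fromList⁻ (vertices w) x∈)
    E⊆M : ∀ {f} → f ∈ E K ⊎ f ∈ E e* → f ∈ E M
    E⊆M (inj₁ f∈) = proj₂ K⊑M f∈
    E⊆M (inj₂ f∈) = walk-edges⊆ w (∈-fromList⁻ (edges w) f∈)
    K∪e⊑K : K ∪ᴳ e* ⊑ K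
    K∪e⊑K = maximal (K ∪ᴳ e*)
      ((λ x∈ → V⊆M (x∈p∪q⁻ (V K) (V e*) x∈)) , (λ f∈ → E⊆M (x∈p∪q⁻ (E K) (E e*) f∈)))
      (Connected-∪ conn e*-connected u∈K (∈-fromList⁺ (start∈ w)))
      (p⊆p∪q (V e*) , p⊆p∪q (E e*))

  -- Cycles and bicycles in a cacti-graph

  degree-mono : ∀ {H K : Subgraph G} → E H ⊆ E K → ∀ v → degree H v ≤ degree K v
  degree-mono {H} {K} H⊆K v = deg-mono {E H} {E K} {v} (λ e∈ _ → H⊆K e∈)

  2≤degree-∪ : ∀ {H P : Subgraph G} → (∀ {z} → z ∈ V H → 2 ≤ degree H z) →
               (∀ {z} → z ∈ V P → z ∉ V H → 2 ≤ degree P z) →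
               ∀ {z} → z ∈ V H ∪ V P → 2 ≤ degree (H ∪ᴳ P) z
  2≤degree-∪ {H} {P} 2≤H 2≤P {z} z∈ with z ∈? V H | x∈p∪q⁻ (V H) (V P) z∈
  ... | yes z∈H | _        = ≤-trans (2≤H z∈H) (degree-mono {H} {H ∪ᴳ P} (p⊆p∪q (E P)) z)
  ... | no z∉H  | inj₁ z∈H = contradiction z∈H z∉H
  ... | no z∉H  | inj₂ z∈P = ≤-trans (2≤P z∈P z∉H) (degree-mono {P} {H ∪ᴳ P} (q⊆p∪q (E H) (E P)) z)

  single : Vertex → Subgraph G
  single v = mkSubgraph ⁅ v ⁆ ⊥ (λ e∈ → contradiction e∈ ∉⊥)

  record ReachableCycle (M : Subgraph G) (v : Vertex) : Set where
    field
      C       : Subgraph G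
      C⊑M     : C ⊑ M
      isCycle : IsCycle C
      size    : ∣ E C ∣ ≡ ∣ V C ∣
      c       : Vertex
      c∈C     : c ∈ V C
      walk    : Walk M v c

  record ReachableBicycle (M : Subgraph G) (v : Vertex) : Set where
    field
      B         : Subgraph G
      B⊑M       : B ⊑ M
      connected : Connected B
      2≤degree  : ∀ {z} → z ∈ V B → 2 ≤ degree B z
      size      : ∣ E B ∣ ≡ suc ∣ V B ∣
      b         : Vertex
      b∈B       : b ∈ V B
      3≤degree  : 3 ≤ degree B b
      walk      : Walk M v b

  module _ {M : Subgraph G} (cacti : IsCacti M) where
    open IsCacti cacti

    -- An ear of the edgeless graph on `v` is no path, since both ends would be `v`. It is a cycle
    -- through `v`, or a lollipop whose stick leads from `v` to a cycle.
    reachable-cycle : ∀ {v} → v ∈ V M → ReachableCycle M v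
    reachable-cycle {v} v∈M
      with e , e∈M , i ← incident-edge {M} (noIsolated v) v∈M
      with attach-ear {M} {single v} noLeaf (x∈⁅x⁆ v) e∈M ∉⊥ i
    ... | P , path {x = x} {y} p v∩P , _ = contradiction
          (trans (≡v (p⊆p∪q ⁅ y ⁆ (x∈⁅x⁆ x))) (sym (≡v (q⊆p∪q ⁅ x ⁆ ⁅ y ⁆ (x∈⁅x⁆ y))))) (proj₁ p)
      where
      ≡v : ∀ {z} → z ∈ ⁅ x ⁆ ∪ ⁅ y ⁆ → z ≡ v
      ≡v z∈ = x∈⁅y⁆⇒x≡y v (proj₁ (x∈p∩q⁻ ⁅ v ⁆ (V P) (subst (_ ∈_) (sym v∩P) z∈)))
    ... | P , cycle c size v∩P , P⊑M , _ with x∈v , x∈P ← ∈-∩-⁅⁆ v∩P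
      with refl ← x∈⁅y⁆⇒x≡y v x∈v = record
      { C = P ; C⊑M = P⊑M ; isCycle = c ; size = size ; c = v ; c∈C = x∈P ; walk = ε }
    ... | _ , ear@(lollipop {C} {P} {y = y} c size p C∩P v∩Q) , Q⊑M , _
      with x∈v , x∈Q ← ∈-∩-⁅⁆ v∩Q | y∈C , _ ← ∈-∩-⁅⁆ C∩P
      with refl ← x∈⁅y⁆⇒x≡y v x∈v = record
      { C = C ; C⊑M = (proj₁ Q⊑M ∘ p⊆p∪q (V P)) , (proj₂ Q⊑M ∘ p⊆p∪q (E P))
      ; isCycle = c ; size = size ; c = y ; c∈C = y∈C
      ; walk = walk-mono (proj₂ Q⊑M) (proj₂ (ear-connected ear) x∈Q (p⊆p∪q (V P) y∈C)) }

    -- A connected subgraph without exit is a component, which `noCycleComponent` forbids for a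
    -- cycle.
    cycle-exit : ∀ {C} → C ⊑ M → IsCycle C → Exit M C
    cycle-exit {C} C⊑M cyc with exit? M C
    ... | yes exit = exit
    ... | no ¬exit = contradiction cyc (noCycleComponent C (no-exit⇒ComponentOf {M} {C} C⊑M (proj₁ cyc) ¬exit))

    reachable-bicycle : ∀ {v} → v ∈ V M → ReachableBicycle M v
    reachable-bicycle {v} v∈M
      with record { C = C ; C⊑M = C⊑M ; isCycle = cyc ; size = size ; c∈C = c∈C ; walk = walk }
             ← reachable-cycle v∈M
      with e , e∈M , e∉C , x , x∈C , i ← cycle-exit C⊑M cyc
      with P , ear , P⊑M , P#C ← attach-ear {M} {C} noLeaf x∈C e∈M e∉C i
      with b , b∈C , b∈P , 1≤ ← ear-anchor ear = record
      { B = C ∪ᴳ P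
      ; B⊑M = (λ z∈ → [ proj₁ C⊑M , proj₁ P⊑M ]′ (x∈p∪q⁻ (V C) (V P) z∈))
            , (λ f∈ → [ proj₂ C⊑M , proj₂ P⊑M ]′ (x∈p∪q⁻ (E C) (E P) f∈))
      ; connected = Connected-∪ (proj₁ cyc) (ear-connected ear) b∈C b∈P
      ; 2≤degree = 2≤degree-∪ {C} {P} (λ z∈ → ≤-reflexive (sym (proj₂ cyc z∈))) (ear-deg ear)
      -- The cycle has Δ = 0 and the ear adds 1.
      ; size = +-cancelʳ-≡ (∣ V C ∣) _ _ (trans (∪-size {C} {P} P#C (ear-size ear))
                 (cong (λ k → suc (∣ V C ∪ V P ∣ + k)) size))
      ; b = b
      ; b∈B = p⊆p∪q (V P) b∈C
      ; 3≤degree = ≤-trans (+-mono-≤ (≤-reflexive (sym (proj₂ cyc b∈C))) 1≤)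
                     (≤-reflexive (sym (deg-∪ (λ f∈C f∈P → P#C f∈P f∈C) b)))
      ; walk = walk ◅◅ walk-mono (proj₂ C⊑M) (proj₂ (proj₁ cyc) c∈C b∈C)
      }

  -- The degree criterion

  record Good (H : Subgraph G) : Set where
    field
      2≤degree : ∀ {v} → v ∈ V H → 2 ≤ degree H v
      branch   : ∀ {v} → v ∈ V H → ∃[ b ] (3 ≤ degree H b × Walk H v b)

  IsCacti⇒Good : ∀ {H} → IsCacti H → Good H
  IsCacti⇒Good {H} cacti = record
    { 2≤degree = λ {v} → 2≤deg {H} (noIsolated v) (noLeaf v)
    ; branch   = λ v∈ → let open ReachableBicycle (reachable-bicycle cacti v∈) in
        b , ≤-trans 3≤degree (degree-mono {B} {H} (proj₂ B⊑M) b) , walk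
    }
    where open IsCacti cacti

  Good⇒IsCacti : ∀ {H} → Good H → IsCacti H
  Good⇒IsCacti {H} good = record
    { noIsolated       = λ v (v∈ , none) →
        contradiction (subst (2 ≤_) (deg-none {E H} none) (2≤degree v∈)) λ ()
    ; noLeaf           = λ v leaf →
        contradiction (2≤degree (proj₁ leaf)) (≤⇒≯ (LeafOf⇒deg≤1 {H} leaf))
    ; noCycleComponent = no-cycle
    }
    where
    open Good good
    no-cycle : ∀ K → ComponentOf H K → ¬ IsCycle K
    -- A component contains every walk from its vertices and all edges at them, so `b` lies in `K`
    -- with its full degree, at least 3.
    no-cycle K comp (((v , v∈K) , _) , deg≡2) with b , 3≤ , w ← branch (proj₁ (proj₁ comp) v∈K) =
      contradiction (≤-trans 3≤ (deg-mono {E H} {E K} {b} (λ e∈ i → component-absorbs {H} {K} comp e∈ b∈K i)))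
        (≤⇒≯ (≤-reflexive (deg≡2 b∈K)))
      where
      b∈K : b ∈ V K
      b∈K = walk-stays {H} (λ e∈ j u∈ → Incident⇒∈V K
        (component-absorbs {H} {K} comp e∈ u∈ (Joins⇒Incidentˡ j)) (Joins⇒Incidentˡ (Joins-sym j))) w v∈K

  -- The two outcomes of `reach` are those of ears, which lead back to `H`, and of bicycles, which
  -- have their own branch vertex.
  Good-∪ : ∀ {H P} → Good H →
           (∀ {z} → z ∈ V P → z ∉ V H → 2 ≤ degree P z) →
           (∀ {z} → z ∈ V P → ∃[ b ] (Walk P z b × (b ∈ V H ⊎ 3 ≤ degree P b))) →
           Good (H ∪ᴳ P)
  Good-∪ {H} {P} good 2≤P reach = record
    { 2≤degree = 2≤degree-∪ {H} {P} 2≤degree 2≤P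
    ; branch   = λ z∈ → [ from-H , from-P ]′ (x∈p∪q⁻ (V H) (V P) z∈)
    }
    where
    open Good good
    H≤ : ∀ z → degree H z ≤ degree (H ∪ᴳ P) z
    H≤ = degree-mono {H} {H ∪ᴳ P} (p⊆p∪q (E P))
    P≤ : ∀ z → degree P z ≤ degree (H ∪ᴳ P) z
    P≤ = degree-mono {P} {H ∪ᴳ P} (q⊆p∪q (E H) (E P))
    from-H : ∀ {z} → z ∈ V H → ∃[ b ] (3 ≤ degree (H ∪ᴳ P) b × Walk (H ∪ᴳ P) z b)
    from-H z∈ with b , 3≤ , w ← branch z∈ = b , ≤-trans 3≤ (H≤ b) , walk-mono (p⊆p∪q (E P)) w
    from-P : ∀ {z} → z ∈ V P → ∃[ b ] (3 ≤ degree (H ∪ᴳ P) b × Walk (H ∪ᴳ P) z b)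
    from-P z∈ with reach z∈
    ... | b , w , inj₂ 3≤ = b , ≤-trans 3≤ (P≤ b) , walk-mono (q⊆p∪q (E H) (E P)) w
    ... | _ , w , inj₁ x∈H with b , 3≤ , w′ ← from-H x∈H =
      b , 3≤ , walk-mono (q⊆p∪q (E H) (E P)) w ◅◅ w′

  open ℤ using (+_)

  -- Attachments and the change of Δ

  -- The contact conditions are implications over every reading of `P` as one of the four kinds,
  -- with any choice of ends. Hence the kinds and ends of a piece have to be told apart.
  Attachment : Subgraph G → Subgraph G → Subgraph G → Set
  Attachment K P K′ =
    K′ ≋ (K ∪ᴳ P)
    × Empty (E P ∩ E K)
    × (IsPath P ⊎ IsCycle P ⊎ IsLollipop P ⊎ IsBicycle P)
    × (∀ x y → PathBetween P x y → V K ∩ V P ≡ ⁅ x ⁆ ∪ ⁅ y ⁆)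
    × (∀ x → LollipopWithEnd P x → V K ∩ V P ≡ ⁅ x ⁆)
    × (IsCycle P → ∣ V K ∩ V P ∣ ≡ 1)
    × (IsBicycle P → Empty (V K ∩ V P))
    × K ⊏ K′
    × Δ K′ ℤ.- Δ K ≡ + 1

  Δ-step : ∀ {K K′ : Subgraph G} → ∣ E K′ ∣ + ∣ V K ∣ ≡ suc (∣ V K′ ∣ + ∣ E K ∣) → Δ K′ ℤ.- Δ K ≡ + 1
  Δ-step {K} {K′} eq = trans
    (S.solve 4 (λ a b c d → (a S.:- b) S.:- (c S.:- d) S.:= (a S.:+ d) S.:- (b S.:+ c)) refl
      (+ ∣ E K′ ∣) (+ ∣ V K′ ∣) (+ ∣ E K ∣) (+ ∣ V K ∣))
    -- A sum of casts computes to the cast of the sum, so the equation in ℕ applies under `+_`.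
    (trans (cong (λ k → + k ℤ.- + (∣ V K′ ∣ + ∣ E K ∣)) eq)
      (S.solve 1 (λ a → (S.con (+ 1) S.:+ a) S.:- a S.:= S.con (+ 1)) refl (+ (∣ V K′ ∣ + ∣ E K ∣))))
    where module S = ℤ-Solver

  Δ≡1⇒size : ∀ {H : Subgraph G} → Δ H ≡ + 1 → ∣ E H ∣ ≡ suc ∣ V H ∣
  Δ≡1⇒size {H} eq = +-injective (trans
    (S.solve 2 (λ a b → a S.:= (a S.:- b) S.:+ b) refl (+ ∣ E H ∣) (+ ∣ V H ∣))
    (cong (ℤ._+ + ∣ V H ∣) eq))
    where module S = ℤ-Solver

  size⇒Δ≡1 : ∀ {H : Subgraph G} → ∣ E H ∣ ≡ suc ∣ V H ∣ → Δ H ≡ + 1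
  size⇒Δ≡1 {H} eq = trans (cong (λ k → + k ℤ.- + ∣ V H ∣) eq)
    (S.solve 1 (λ a → (S.con (+ 1) S.:+ a) S.:- a S.:= S.con (+ 1)) refl (+ ∣ V H ∣))
    where module S = ℤ-Solver

  size⇒⊏ : ∀ {K P : Subgraph G} → ∣ E K ∪ E P ∣ + ∣ V K ∣ ≡ suc (∣ V K ∪ V P ∣ + ∣ E K ∣) → K ⊏ K ∪ᴳ P
  size⇒⊏ {K} {P} eq = (p⊆p∪q (V P) , p⊆p∪q (E P)) ,
    λ (_ , E≡) → <-irrefl (cong ∣_∣ E≡) (∣E∣<∣E∪E∣ {K} {P} eq)

  -- Telling the kinds of pieces apart

  path-end-unique : ∀ {P x y z} → PathBetween P x y → z ∈ V P → degree P z ≡ 1 → z ≡ x ⊎ z ≡ y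
  path-end-unique {P} {x} {y} {z} p z∈ eq with z ≟ x | z ≟ y
  ... | yes z≡x | _       = inj₁ z≡x
  ... | no _    | yes z≡y = inj₂ z≡y
  ... | no z≢x  | no z≢y  = contradiction (path-deg-inner p z∈ z≢x z≢y) (≡1⇒≢2 eq)

  lollipop-end-unique : ∀ {Q x z} → LollipopWithEnd Q x → z ∈ V Q → degree Q z ≡ 1 → z ≡ x
  lollipop-end-unique {Q} {x} {z} l z∈ eq with z ≟ x
  ... | yes z≡x = z≡x
  ... | no z≢x  = contradiction (lollipop-deg-other {Q} l z∈ z≢x) (≡1⇒≱2 eq)

  path-not-lollipop : ∀ {P x y z} → PathBetween P x y → ¬ LollipopWithEnd P z
  path-not-lollipop {P} p l = proj₁ p (trans
    (lollipop-end-unique {P} l (path-start∈ p) (path-deg-start p))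
    (sym (lollipop-end-unique {P} l (path-end∈ p) (path-deg-end p))))

  path-not-cycle : ∀ {P x y} → PathBetween P x y → ¬ IsCycle P
  path-not-cycle {P} {x} p c = ≡1⇒≢2 (path-deg-start p) (proj₂ c (path-start∈ p))

  -- The kind of an ear and its ends are recognised by its vertices of degree 1,
  -- and an ear is not a bicycle because it has at most as many edges as vertices.
  module _ {K : Subgraph G} where

    ear-kind : ∀ {P} → Ear K P → IsPath P ⊎ IsCycle P ⊎ IsLollipop P ⊎ IsBicycle P
    ear-kind (path p _)                        = inj₁ (_ , _ , p)
    ear-kind (cycle c _ _)                     = inj₂ (inj₁ c)
    ear-kind (lollipop {C} {P} c _ p C∩P _) = inj₂ (inj₂ (inj₁ (_ , ear-lollipop C P c p C∩P)))

    ear-ends : ∀ {P} → Ear K P → ∀ x y → PathBetween P x y → V K ∩ V P ≡ ⁅ x ⁆ ∪ ⁅ y ⁆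
    ear-ends (path {x = a} {b} p K∩P) x y q
      with path-end-unique p (path-start∈ q) (path-deg-start q)
         | path-end-unique p (path-end∈ q) (path-deg-end q)
    ... | inj₁ refl | inj₁ refl = contradiction refl (proj₁ q)
    ... | inj₁ refl | inj₂ refl = K∩P
    ... | inj₂ refl | inj₁ refl = trans K∩P (∪-comm ⁅ a ⁆ ⁅ b ⁆)
    ... | inj₂ refl | inj₂ refl = contradiction refl (proj₁ q)
    ear-ends (cycle c _ _) x y q = contradiction c (path-not-cycle q)
    ear-ends (lollipop {C} {P} c _ p C∩P _) x y q =
      contradiction (ear-lollipop C P c p C∩P) (path-not-lollipop q)

    ear-lollipop-end : ∀ {P} → Ear K P → ∀ x → LollipopWithEnd P x → V K ∩ V P ≡ ⁅ x ⁆
    ear-lollipop-end (path p _) x l = contradiction l (path-not-lollipop p)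
    ear-lollipop-end {P} (cycle c _ _) x l = contradiction
      (proj₂ c (lollipop-end∈ {P} l)) (≡1⇒≢2 (lollipop-deg-end {P} l))
    ear-lollipop-end (lollipop {C} {P} c _ p C∩P K∩Q) x l = trans K∩Q (cong ⁅_⁆
      (sym (lollipop-end-unique {C ∪ᴳ P} (ear-lollipop C P c p C∩P)
        (lollipop-end∈ {C ∪ᴳ P} l) (lollipop-deg-end {C ∪ᴳ P} l))))

    ear-cycle : ∀ {P} → Ear K P → IsCycle P → ∣ V K ∩ V P ∣ ≡ 1
    ear-cycle (path p _)                    c = contradiction c (path-not-cycle p)
    ear-cycle (cycle {x = x} _ _ K∩P)       _ = trans (cong ∣_∣ K∩P) (∣⁅x⁆∣≡1 x)
    ear-cycle (lollipop {x = x} _ _ _ _ K∩Q) _ = trans (cong ∣_∣ K∩Q) (∣⁅x⁆∣≡1 x)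

    ear-not-bicycle : ∀ {P} → Ear K P → ¬ IsBicycle P
    ear-not-bicycle {P} ear (_ , _ , Δ≡1) = excess ear (Δ≡1⇒size {P} Δ≡1)
      where
      excess : ∀ {P} → Ear K P → ∣ E P ∣ ≢ suc ∣ V P ∣
      excess (path p _) eq = m≢1+m+n _ (trans eq (trans (cong suc (path-size p)) (cong suc (+-comm 1 _))))
      excess (cycle _ size _) eq = 1+n≢n (trans (sym eq) size)
      excess (lollipop c size p C∩P _) eq = 1+n≢n (trans (sym eq) (lollipop-size c size p C∩P))

    attach : ∀ {P} → Ear K P → Disjoint (E P) (E K) → Attachment K P (K ∪ᴳ P)
    attach {P} ear P#K = (refl , refl) , Disjoint⇒Empty P#K , ear-kind ear , ear-ends ear
      , ear-lollipop-end ear , ear-cycle ear , (λ bi → contradiction bi (ear-not-bicycle ear))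
      , size⇒⊏ {K} {P} size , Δ-step {K} {K ∪ᴳ P} size
      where
      size = ∪-size {K} {P} P#K (ear-size ear)

  -- One step of the construction

  Advance : Subgraph G → Set
  Advance H = ∃[ P ] (Attachment H P (H ∪ᴳ P) × Good (H ∪ᴳ P) × ∣ E H ∣ < ∣ E H ∪ E P ∣)

  advance-ear : ∀ {H M} → Good H → EarIn M H → Advance H
  advance-ear {H} good (P , ear , _ , P#H) = P , attach ear P#H
    , Good-∪ {H} {P} good (ear-deg ear) (λ z∈ → let x , x∈H , x∈P , _ = ear-anchor ear in
        x , proj₂ (ear-connected ear) z∈ x∈P , inj₁ x∈H)
    , ∣E∣<∣E∪E∣ {H} {P} (∪-size {H} {P} P#H (ear-size ear))

  -- `B` cannot be read as a path or lollipop, which have a vertex of degree 1, nor as a cycle,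
  -- because of `b`.
  advance-bicycle : ∀ {H M v} → Good H → ¬ Exit M H → v ∉ V H → ReachableBicycle M v → Advance H
  advance-bicycle {H} {M} {v} good ¬exit v∉H bicycle = B
    , ( (refl , refl) , Disjoint⇒Empty EB#EH , inj₂ (inj₂ (inj₂ isBicycle))
      , (λ x y p → contradiction (2≤degree (path-start∈ p)) (≡1⇒≱2 (path-deg-start p)))
      , (λ x l → contradiction (2≤degree (lollipop-end∈ {B} l)) (≡1⇒≱2 (lollipop-deg-end {B} l)))
      , (λ c → contradiction 3≤degree (≤⇒≯ (≤-reflexive (proj₂ c b∈B))))
      , (λ _ → Disjoint⇒Empty VH#VB)
      , size⇒⊏ {H} {B} total , Δ-step {H} {H ∪ᴳ B} total)
    , Good-∪ {H} {B} good (λ z∈ _ → 2≤degree z∈) (λ z∈ → b , proj₂ connected z∈ b∈B , inj₂ 3≤degree)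
    , ∣E∣<∣E∪E∣ {H} {B} total
    where
    open ReachableBicycle bicycle
    VH#VB : Disjoint (V H) (V B)
    -- A common vertex would be joined to `v` through `b`, and without an exit that walk could not
    -- leave `H`.
    VH#VB z∈H z∈B = v∉H (walk-stays {M} (no-exit⇒closed {M} {H} ¬exit)
      (walk-mono (proj₂ B⊑M) (proj₂ connected z∈B b∈B) ◅◅ reverseʷ walk) z∈H)
    EB#EH : Disjoint (E B) (E H)
    EB#EH e∈B e∈H = VH#VB (Incident⇒∈V H e∈H (inj₁ refl)) (Incident⇒∈V B e∈B (inj₁ refl))
    isBicycle : IsBicycle B
    isBicycle = connected
      , (λ z leaf → contradiction (2≤degree (proj₁ leaf)) (≤⇒≯ (LeafOf⇒deg≤1 {B} leaf)))
      , size⇒Δ≡1 {B} size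
    total : ∣ E H ∪ E B ∣ + ∣ V H ∣ ≡ suc (∣ V H ∪ V B ∣ + ∣ E H ∣)
    total = ∪-size {H} {B} EB#EH (trans
      (cong (λ p → ∣ E B ∣ + ∣ p ∣) (Empty-unique (Disjoint⇒Empty VH#VB)))
      (trans (cong (λ k → ∣ E B ∣ + k) (∣⊥∣≡0 nV)) (trans (+-identityʳ _) size)))

  -- Iteration up to the whole graph

  module _ (cacti : IsCacti (whole G)) where

    advance : ∀ {H} → Good H → H ≋ whole G ⊎ Advance H
    advance {H} good with exit? (whole G) H | any? (λ v → ¬? (v ∈? V H))
    ... | yes (e , e∈ , e∉ , v , v∈ , i) | _ =
      inj₂ (advance-ear {H} {whole G} good (attach-ear {whole G} {H} (IsCacti.noLeaf cacti) v∈ e∈ e∉ i))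
    -- This includes an empty `H`, whose first piece is therefore a bicycle.
    ... | no ¬exit | yes (v , v∉) =
      inj₂ (advance-bicycle {H} good ¬exit v∉ (reachable-bicycle cacti ∈⊤))
    ... | no ¬exit | no none = inj₁
      ( ⊆-antisym ⊆⊤ (λ {v} _ → V-all v)
      , ⊆-antisym ⊆⊤ (λ {e} e∈ → no-exit⇒∈E {whole G} {H} ¬exit e∈ (V-all (src e)) (inj₁ refl)))
      where
      V-all : ∀ v → v ∈ V H
      V-all v with v ∈? V H
      ... | yes v∈ = v∈
      ... | no v∉  = contradiction (v , v∉) none

    -- The start is fixed up to `≡`, not just `≋`, so that the first attachment can be transported
    -- along it when a graph is put in front.
    Construction : Subgraph G → Set
    Construction H₀ = ∃[ r ] Σ[ P ∈ (Fin r → Subgraph G) ] Σ[ H ∈ (Fin (suc r) → Subgraph G) ]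
      ( H zero ≡ H₀ × H (fromℕ r) ≋ whole G × (∀ j → IsCacti (H j))
      × (∀ i → Attachment (H (inject₁ i)) (P i) (H (suc i))))

    -- Each advance gains an edge and so pays for one unit of `k`; with `k` at zero, `H` would have
    -- more than `nE` edges.
    construct : ∀ k {H} → Good H → nE < k + ∣ E H ∣ → Construction H
    construct zero {H} _ bound = contradiction bound (≤⇒≯ (∣p∣≤n (E H)))
    construct (suc k) {H} good bound with advance good
    ... | inj₁ H≋G = 0 , (λ ()) , (λ _ → H) , refl , H≋G , (λ _ → Good⇒IsCacti good) , λ ()
    ... | inj₂ (P₁ , attachment , good′ , grows)
      with construct k good′ (≤-trans bound
             (≤-trans (≤-reflexive (sym (+-suc k _))) (+-monoʳ-≤ k grows)))
    ... | r , P , Hs , start , last , cactis , attachments = suc r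
      , (λ { zero → P₁ ; (suc i) → P i })
      , (λ { zero → H ; (suc j) → Hs j })
      , refl , last
      , (λ { zero → Good⇒IsCacti good ; (suc j) → cactis j })
      , (λ { zero → subst (Attachment H P₁) (sym start) attachment ; (suc i) → attachments i })

open ℤ using (+_)

mainTheorem4 : (G : Multigraph) (G₀ : Subgraph G) →
    IsCacti (whole G) → IsCacti G₀ →
    (whole G ≋ G₀)
    ⊎ (∃[ r ] Σ[ P ∈ (Fin r → Subgraph G) ] Σ[ H ∈ (Fin (ℕ.suc r) → Subgraph G) ]
    ( 1 ≤ r
    × H zero ≋ G₀
    × H (fromℕ r) ≋ whole G
    × (∀ j → IsCacti (H j))
    × (∀ (i : Fin r) →
    H (suc i) ≋ (H (inject₁ i) ∪ᴳ P i)
    × Empty (E (P i) ∩ E (H (inject₁ i)))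
    × (IsPath (P i) ⊎ IsCycle (P i) ⊎ IsLollipop (P i) ⊎ IsBicycle (P i))
    × (∀ x y → PathBetween (P i) x y → V (H (inject₁ i)) ∩ V (P i) ≡ ⁅ x ⁆ ∪ ⁅ y ⁆)
    × (∀ x → LollipopWithEnd (P i) x → V (H (inject₁ i)) ∩ V (P i) ≡ ⁅ x ⁆)
    × (IsCycle (P i) → ∣ V (H (inject₁ i)) ∩ V (P i) ∣ ≡ 1)
    × (IsBicycle (P i) → Empty (V (H (inject₁ i)) ∩ V (P i)))
    × H (inject₁ i) ⊏ H (suc i)
    × Δ (H (suc i)) ℤ.- Δ (H (inject₁ i)) ≡ + 1)))
mainTheorem4 G G₀ cacti cacti₀
  with construct cacti (suc (Multigraph.nE G)) (IsCacti⇒Good cacti₀) (m≤m+n _ _)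
-- With no step taken, the first graph, which is `G₀`, is also the last.
... | zero  , _ , _ , refl , (V≡ , E≡) , _ = inj₁ (sym V≡ , sym E≡)
... | suc r , P , H , refl , last , cactis , attachments =
  inj₂ (suc r , P , H , s≤s z≤n , (refl , refl) , last , cactis , attachments)
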